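{- Let $G$ be a finite simple connected graph with adjacency matrix $A$ having eigenvalues $\mu_1\ge\mu_2\ge\cdots\ge\mu_n$, and suppose $\mu_2(A)>0$. Let $g$ be the multiplicity of the smallest eigenvalue $\mu_n(A)$. Then \[ \chi_q(G)\ \ge\ 1+\min\left\{g,\ \frac{|\mu_n(A)|}{\mu_2(A)}\right\}. \]
   Context: A quantum $c$-coloring of a graph $G=(V,E)$ is a collection of orthogonal projectors $\{P_{v,k}: v\in V, k\in[c]\}$ in $\mathbb{C}^{d\times d}$, for some integer $d>0$, such that $\sum_{k\in[c]}P_{v,k}=I_d$ for every vertex $v\in V$, and $P_{v,k}P_{w,k}=0_d$ for every edge $vw\in E$ and every $k\in[c]$. The quantum chromatic number $\chi_q(G)$ is the smallest $c$ for which $G$ admits a quantum $c$-coloring in some dimension $d>0$. -}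

module Defs where

open import Level using (0ℓ)
open import Algebra.Bundles using (CommutativeRing; RawRing)
open import Algebra.Structures using (IsCommutativeRing)
import Algebra.Construct.NaturalChoice.Max as NaturalMax
import Algebra.Construct.NaturalChoice.Min as NaturalMin
import Algebra.Definitions.RawSemiring as RawSemiringDefinitions
open import Data.Bool.Base using (if_then_else_)
open import Data.Fin.Base using (Fin)
import Data.Fin.Base as Fin
import Data.Fin.Properties as Fin
open import Data.Nat.Base using (ℕ)
import Data.Nat.Base as ℕ
open import Data.Product.Base using (∃; _×_; _,_)
import Data.Vec.Base as Vec
open import Data.Vec.Functional using (Vector)
open import Relation.Binary.Bundles using (DecTotalOrder)
open import Relation.Binary.Construct.Closure.ReflexiveTransitive using (Star)
import Relation.Binary.Construct.NonStrictToStrict as ToStrict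
open import Relation.Binary.Core using (Rel)
open import Relation.Binary.Definitions using (Decidable; Irreflexive; Symmetric)
open import Relation.Binary.PropositionalEquality.Core using (_≡_)
open import Relation.Binary.Structures using (IsDecTotalOrder)
open import Relation.Nullary.Decidable.Core using (does)
open import Relation.Nullary.Negation.Core using (¬_)

-- The real numbers of classical mathematics, characterised up to
-- isomorphism as a Dedekind-complete ordered field.  The order is decidable
-- because it is the classical reals that are described.
record Reals : Set₁ where
  infix  4 _≈_ _≤_
  infixl 6 _+_
  infixl 7 _*_ _/_
  infix  8 -_ _⁻¹
  field
    Carrier           : Set
    _≈_ _≤_           : Rel Carrier 0ℓ
    _+_ _*_           : Carrier → Carrier → Carrier
    -_ _⁻¹            : Carrier → Carrier
    0# 1#             : Carrier
    isCommutativeRing : IsCommutativeRing _≈_ _+_ _*_ -_ 0# 1#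
    isDecTotalOrder   : IsDecTotalOrder _≈_ _≤_
    1≉0               : ¬ (1# ≈ 0#)
    -- 0# ⁻¹ is left unspecified.
    ⁻¹-cong           : ∀ {x y} → x ≈ y → x ⁻¹ ≈ y ⁻¹
    ⁻¹-inverseʳ       : ∀ x → ¬ (x ≈ 0#) → x * x ⁻¹ ≈ 1#
    +-monoˡ-≤         : ∀ z {x y} → x ≤ y → x + z ≤ y + z
    *-nonNegative     : ∀ {x y} → 0# ≤ x → 0# ≤ y → 0# ≤ x * y

  UpperBound : (Carrier → Set) → Carrier → Set
  UpperBound P b = ∀ x → P x → x ≤ b

  field
    supremum : (P : Carrier → Set) → ∃ P → ∃ (UpperBound P) →
               ∃ λ s → UpperBound P s × (∀ b → UpperBound P b → s ≤ b)

  commutativeRing : CommutativeRing 0ℓ 0ℓ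
  commutativeRing = record { isCommutativeRing = isCommutativeRing }

  rawRing : RawRing 0ℓ 0ℓ
  rawRing = CommutativeRing.rawRing commutativeRing

  decTotalOrder : DecTotalOrder 0ℓ 0ℓ 0ℓ
  decTotalOrder = record { isDecTotalOrder = isDecTotalOrder }

  open IsDecTotalOrder isDecTotalOrder public using (_≟_; _≤?_)
  open ToStrict _≈_ _≤_ public using (_<_)
  open NaturalMax (DecTotalOrder.totalOrder decTotalOrder) public using (_⊔_)
  open NaturalMin (DecTotalOrder.totalOrder decTotalOrder) public using (_⊓_)

  _/_ : Carrier → Carrier → Carrier
  x / y = x * y ⁻¹

  ∣_∣ : Carrier → Carrier
  ∣ x ∣ = x ⊔ (- x)

  fromℕ : ℕ → Carrier
  fromℕ n = n ×ₙ 1#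
    where open RawSemiringDefinitions (RawRing.rawSemiring rawRing)
            renaming (_×_ to _×ₙ_)

module LinearAlgebra (R : RawRing 0ℓ 0ℓ) where
  open RawRing R
  open RawSemiringDefinitions rawSemiring using (sum)

  Matrix : ℕ → ℕ → Set
  Matrix m n = Vector (Vector Carrier n) m

  infix 4 _≋_ _≈ᴹ_

  _≋_ : ∀ {n} → Rel (Vector Carrier n) 0ℓ
  u ≋ v = ∀ i → u i ≈ v i

  _≈ᴹ_ : ∀ {m n} → Rel (Matrix m n) 0ℓ
  A ≈ᴹ B = ∀ i j → A i j ≈ B i j

  infixl 7 _*ᴹ_ _*ⱽ_ _•_

  _*ᴹ_ : ∀ {l m n} → Matrix l m → Matrix m n → Matrix l n
  (A *ᴹ B) i j = sum λ k → A i k * B k j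

  _*ⱽ_ : ∀ {m n} → Matrix m n → Vector Carrier n → Vector Carrier m
  (A *ⱽ v) i = sum λ j → A i j * v j

  _•_ : ∀ {n} → Carrier → Vector Carrier n → Vector Carrier n
  (a • v) i = a * v i

  0ⱽ : ∀ {n} → Vector Carrier n
  0ⱽ _ = 0#

  0ᴹ : ∀ {m n} → Matrix m n
  0ᴹ _ _ = 0#

  1ᴹ : ∀ {n} → Matrix n n
  1ᴹ i j = if does (i Fin.≟ j) then 1# else 0#

  sumᴹ : ∀ {k m n} → Vector (Matrix m n) k → Matrix m n
  sumᴹ M i j = sum λ l → M l i j

  linearCombination : ∀ {k n} → Vector Carrier k →
                      Vector (Vector Carrier n) k → Vector Carrier n
  linearCombination a b i = sum λ l → a l * b l i

  LinearlyIndependent : ∀ {k n} → Vector (Vector Carrier n) k → Set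
  LinearlyIndependent b = ∀ a → linearCombination a b ≋ 0ⱽ → a ≋ 0ⱽ

  HasDimension : ∀ {n} → (Vector Carrier n → Set) → ℕ → Set
  HasDimension {n} V k = ∃ λ (b : Vector (Vector Carrier n) k) →
    (∀ l → V (b l)) ×
    LinearlyIndependent b ×
    (∀ v → V v → ∃ λ a → v ≋ linearCombination a b)

  Eigenspace : ∀ {n} → Matrix n n → Carrier → Vector Carrier n → Set
  Eigenspace A λ′ v = A *ⱽ v ≋ λ′ • v

  -- For the symmetric matrices considered here geometric and algebraic
  -- multiplicities coincide.
  HasMultiplicity : ∀ {n} → Matrix n n → Carrier → ℕ → Set
  HasMultiplicity A λ′ k = HasDimension (Eigenspace A λ′) k

-- Finite simple graphs on the vertex set Fin n.
record Graph (n : ℕ) : Set₁ where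
  infix 4 _~_ _~?_
  field
    _~_      : Rel (Fin n) 0ℓ
    _~?_     : Decidable _~_
    ~-sym    : Symmetric _~_
    ~-irrefl : Irreflexive _≡_ _~_

Connected : ∀ {n} → Graph n → Set
Connected G = ∀ v w → Star _~_ v w
  where open Graph G

module Spectrum (ℝ : Reals) where
  open Reals ℝ
  open LinearAlgebra rawRing public

  adjacencyMatrix : ∀ {n} → Graph n → Matrix n n
  adjacencyMatrix G v w = if does (v ~? w) then 1# else 0#
    where open Graph G

  -- μ lists all eigenvalues of A in non-increasing order, each as often as
  -- its multiplicity (values that are not eigenvalues have multiplicity 0).
  IsSpectrum : ∀ {n} → Matrix n n → Vector Carrier n → Set
  IsSpectrum A μ =
    (∀ {i j} → i Fin.≤ j → μ j ≤ μ i) ×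
    (∀ x → HasMultiplicity A x (Vec.count (_≟ x) (Vec.tabulate μ)))

module Complex (ℝ : Reals) where
  private module R = Reals ℝ

  infix 5 _+i_

  record ℂ : Set where
    constructor _+i_
    field
      re im : R.Carrier

  open ℂ public

  rawRing : RawRing 0ℓ 0ℓ
  rawRing = record
    { Carrier = ℂ
    ; _≈_     = λ z w → re z R.≈ re w × im z R.≈ im w
    ; _+_     = λ z w → (re z R.+ re w) +i (im z R.+ im w)
    ; _*_     = λ z w → (re z R.* re w R.+ R.- (im z R.* im w))
                     +i (re z R.* im w R.+ im z R.* re w)
    ; -_      = λ z → (R.- re z) +i (R.- im z)
    ; 0#      = R.0# +i R.0#
    ; 1#      = R.1# +i R.0#
    }

  conjugate : ℂ → ℂ
  conjugate z = re z +i (R.- im z)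

module QuantumColoring (ℝ : Reals) where
  open Complex ℝ
  open LinearAlgebra rawRing

  infix 8 _†

  _† : ∀ {m n} → Matrix m n → Matrix n m
  (M †) i j = conjugate (M j i)

  IsOrthogonalProjector : ∀ {d} → Matrix d d → Set
  IsOrthogonalProjector P = (P *ᴹ P ≈ᴹ P) × (P † ≈ᴹ P)

  record QuantumColoring {n} (G : Graph n) (c d : ℕ) : Set where
    open Graph G
    field
      P           : Fin n → Fin c → Matrix d d
      isProjector : ∀ v k → IsOrthogonalProjector (P v k)
      complete    : ∀ v → sumᴹ (P v) ≈ᴹ 1ᴹ
      proper      : ∀ {v w} → v ~ w → ∀ k → P v k *ᴹ P w k ≈ᴹ 0ᴹ

  QuantumColorable : ∀ {n} → Graph n → ℕ → Set
  QuantumColorable G c = ∃ λ d → 0 ℕ.< d × QuantumColoring G c d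

  -- A relation, since a least c cannot be computed in general.
  IsQuantumChromaticNumber : ∀ {n} → Graph n → ℕ → Set
  IsQuantumChromaticNumber G χ =
    QuantumColorable G χ × (∀ c → QuantumColorable G c → χ ℕ.≤ c)

{-# OPTIONS --safe #-}
-- Let Pₖ = Σᵥ eᵥeᵥᵀ ⊗ P v k.  These projectors on ℝⁿ ⊗ ℝᵈ (complex matrices
-- being replaced by real ones of twice the size) resolve the identity, and
-- Pₖ (A ⊗ I) Pₖ = 0 because the coloring is proper.  Let b₀ be a μ₁-eigenvector
-- of A.  If g ≥ χ, then the gd-dimensional space E(μₙ) ⊗ ℝᵈ contains a nonzero x
-- for which every Pₖ x is orthogonal to b₀ ⊗ ℝᵈ: these are only (χ − 1)d
-- conditions, since the one for Σₖ Pₖ x = x is automatic.  On the orthogonal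
-- complement of b₀ ⊗ ℝᵈ the quadratic form F y = μ₂ ⟨y, y⟩ − ⟨y, (A ⊗ I) y⟩ is
-- positive semidefinite, so F (Σₖ Pₖ x) ≤ χ Σₖ F (Pₖ x).  The left side is
-- (μ₂ − μₙ) ⟨x, x⟩ and the right side is χ μ₂ ⟨x, x⟩, hence −μₙ ≤ (χ − 1) μ₂.

module Submission where

-- The eigenbasis behind F comes from the listed multiplicities: `μ` has n entries, and each
-- eigenspace supplies as many independent vectors as its eigenvalue has entries, so a greedy choice
-- of orthogonal eigenvectors fills ℝⁿ. In these coordinates F is a combination of squares whose
-- coefficients have the signs of μ₂ - μᵢ. Only the one at b₀ can be negative, which is what forces
-- the orthogonality conditions. The factor χ is Cauchy-Schwarz for a sum of χ numbers, applied in
-- each coordinate. The automatic condition rests on μₙ ≠ μ₁: the zero diagonal of `A` gives μₙ ≤ 0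
-- < μ₂ ≤ μ₁, so E(μₙ) is orthogonal to b₀. Doubling d for real matrices is harmless, since d is a
-- factor on both sides of the count (χ - 1)d < gd. If g < χ, then g itself is at most χ - 1; this
-- is where the minimum comes from.

open import Defs
open import Algebra.Bundles using (CommutativeRing; RawRing)
import Algebra.Construct.NaturalChoice.Max as NaturalMax
import Algebra.Construct.NaturalChoice.Min as NaturalMin
import Algebra.Definitions.RawSemiring as RawSemiringDefinitions
import Algebra.Solver.Ring as RingSolver
open import Algebra.Solver.Ring.AlmostCommutativeRing
  using (AlmostCommutativeRing; fromCommutativeRing; _-Raw-AlmostCommutative⟶_; Induced-equivalence)
open import Data.Bool.Base using (true; false; if_then_else_)
open import Data.Fin.Base as Fin
  using (Fin; zero; suc; punchIn; combine; remQuot; splitAt; join; _↑ˡ_; _↑ʳ_)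
import Data.Fin.Properties as Fin
open import Data.Integer.Base as ℤ using (ℤ; -[1+_]; _⊖_)
import Data.Integer.Properties as ℤ
open import Data.Maybe.Base using (just; nothing)
open import Data.Nat.Base as ℕ using (ℕ; zero; suc; s≤s; z≤n)
import Data.Nat.Properties as ℕ
open import Data.Product.Base using (∃; ∃₂; _×_; _,_; proj₁; proj₂)
import Data.Sign.Base as Sign
open import Data.Sum.Base using (_⊎_; inj₁; inj₂)
open import Data.Unit.Base using (⊤; tt)
import Data.Vec.Base as Vec
open import Data.Vec.Functional using (Vector; _∷_; insertAt)
import Data.Vec.Functional.Properties as Vector
open import Function.Base using (id; _∘_)
open import Level using (0ℓ)
open import Relation.Binary.Bundles using (DecTotalOrder)
open import Relation.Binary.Definitions using (WeaklyDecidable; tri<; tri≈; tri>)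
open import Relation.Binary.PropositionalEquality.Core as ≡ using (_≡_; _≢_)
open import Relation.Nullary.Decidable.Core using (yes; no; does; ¬?; _×-dec_; decidable-stable)
open import Relation.Nullary.Negation.Core using (¬_; contradiction)
open import Relation.Unary using (Decidable)

-- Integer coefficients let the solver cancel x − x; with coefficients in the
-- abstract ring itself, 1 − 1 does not compute to 0.
module IntegerSolver (R : CommutativeRing 0ℓ 0ℓ) where
  open CommutativeRing R
  open import Algebra.Properties.Ring ring
  open import Algebra.Properties.Semiring.Mult.TCOptimised semiring
    using (1+×; ×-homo-+; ×1-homo-*) renaming (_×_ to _·_)
  open import Relation.Binary.Reasoning.Setoid setoid

  private
    fromℤ : ℤ → Carrier
    fromℤ (ℤ.+ n)  = n · 1#
    fromℤ -[1+ n ] = - (suc n · 1#)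

    fromℤ-⊖ : ∀ m n → fromℤ (m ⊖ n) ≈ m · 1# - n · 1#
    fromℤ-⊖ m zero = sym (trans (+-congˡ -0#≈0#) (+-identityʳ _))
    fromℤ-⊖ zero (suc n) = sym (+-identityˡ _)
    fromℤ-⊖ (suc m) (suc n) = begin
      fromℤ (suc m ⊖ suc n)                ≡⟨ ≡.cong fromℤ (ℤ.[1+m]⊖[1+n]≡m⊖n m n) ⟩
      fromℤ (m ⊖ n)                        ≈⟨ fromℤ-⊖ m n ⟩
      m · 1# - n · 1#                      ≈⟨ +-congʳ (xyx⁻¹≈y 1# _) ⟨
      1# + m · 1# - 1# - n · 1#            ≈⟨ +-assoc _ _ _ ⟩
      1# + m · 1# + (- 1# - n · 1#)        ≈⟨ +-congˡ (-‿+-comm _ _) ⟩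
      1# + m · 1# - (1# + n · 1#)          ≈⟨ +-cong (1+× m 1#) (-‿cong (1+× n 1#)) ⟨
      suc m · 1# - suc n · 1#              ∎

    fromℤ-+ : ∀ i j → fromℤ (i ℤ.+ j) ≈ fromℤ i + fromℤ j
    fromℤ-+ (ℤ.+ m)  (ℤ.+ n)  = ×-homo-+ 1# m n
    fromℤ-+ (ℤ.+ m)  -[1+ n ] = fromℤ-⊖ m (suc n)
    fromℤ-+ -[1+ m ] (ℤ.+ n)  = trans (fromℤ-⊖ n (suc m)) (+-comm _ _)
    fromℤ-+ -[1+ m ] -[1+ n ] = begin
      - (suc (suc (m ℕ.+ n)) · 1#)         ≡⟨ ≡.cong (λ k → - (suc k · 1#)) (ℕ.+-suc m n) ⟨
      - ((suc m ℕ.+ suc n) · 1#)           ≈⟨ -‿cong (×-homo-+ 1# (suc m) (suc n)) ⟩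
      - (suc m · 1# + suc n · 1#)          ≈⟨ -‿+-comm _ _ ⟨
      - (suc m · 1#) - suc n · 1#          ∎

    fromℤ-+◃ : ∀ n → fromℤ (Sign.+ ℤ.◃ n) ≈ n · 1#
    fromℤ-+◃ n = reflexive (≡.cong fromℤ (ℤ.+◃n≡+n n))

    fromℤ--◃ : ∀ n → fromℤ (Sign.- ℤ.◃ n) ≈ - (n · 1#)
    fromℤ--◃ zero    = sym -0#≈0#
    fromℤ--◃ (suc n) = refl

    fromℤ-* : ∀ i j → fromℤ (i ℤ.* j) ≈ fromℤ i * fromℤ j
    fromℤ-* (ℤ.+ m)  (ℤ.+ n)  = trans (fromℤ-+◃ (m ℕ.* n)) (×1-homo-* m n)
    fromℤ-* (ℤ.+ m)  -[1+ n ] = begin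
      fromℤ (Sign.- ℤ.◃ m ℕ.* suc n)       ≈⟨ fromℤ--◃ (m ℕ.* suc n) ⟩
      - ((m ℕ.* suc n) · 1#)               ≈⟨ -‿cong (×1-homo-* m (suc n)) ⟩
      - (m · 1# * (suc n · 1#))            ≈⟨ -‿distribʳ-* _ _ ⟩
      m · 1# * - (suc n · 1#)              ∎
    fromℤ-* -[1+ m ] (ℤ.+ n)  = begin
      fromℤ (Sign.- ℤ.◃ suc m ℕ.* n)       ≈⟨ fromℤ--◃ (suc m ℕ.* n) ⟩
      - ((suc m ℕ.* n) · 1#)               ≈⟨ -‿cong (×1-homo-* (suc m) n) ⟩
      - (suc m · 1# * (n · 1#))            ≈⟨ -‿distribˡ-* _ _ ⟩
      - (suc m · 1#) * (n · 1#)            ∎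
    fromℤ-* -[1+ m ] -[1+ n ] = begin
      (suc m ℕ.* suc n) · 1#               ≈⟨ ×1-homo-* (suc m) (suc n) ⟩
      suc m · 1# * (suc n · 1#)            ≈⟨ -‿involutive _ ⟨
      - - (suc m · 1# * (suc n · 1#))      ≈⟨ -‿cong (-‿distribˡ-* _ _) ⟩
      - (- (suc m · 1#) * (suc n · 1#))    ≈⟨ -‿distribʳ-* _ _ ⟩
      - (suc m · 1#) * - (suc n · 1#)      ∎

    fromℤ-neg : ∀ i → fromℤ (ℤ.- i) ≈ - fromℤ i
    fromℤ-neg (ℤ.+ zero)  = sym -0#≈0#
    fromℤ-neg (ℤ.+ suc n) = refl
    fromℤ-neg -[1+ n ]    = sym (-‿involutive _)

    almostCommutativeRing : AlmostCommutativeRing 0ℓ 0ℓ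
    almostCommutativeRing = fromCommutativeRing R

    morphism : CommutativeRing.rawRing ℤ.+-*-commutativeRing -Raw-AlmostCommutative⟶ almostCommutativeRing
    morphism = record
      { ⟦_⟧    = fromℤ
      ; +-homo = fromℤ-+
      ; *-homo = fromℤ-*
      ; -‿homo = fromℤ-neg
      ; 0-homo = refl
      -- The optimised multiple `1 · 1#` reduces to `1#`, so `con (ℤ.+ 1)` stands for `1#`
      -- definitionally in the solver equations.
      ; 1-homo = refl
      }

    _coeff≟_ : WeaklyDecidable (Induced-equivalence morphism)
    i coeff≟ j with i ℤ.≟ j
    ... | yes i≡j = just (reflexive (≡.cong fromℤ i≡j))
    ... | no  _   = nothing

  open RingSolver _ almostCommutativeRing morphism _coeff≟_ public
    using (solve; _:=_; _:+_; _:*_; _:-_; :-_; con)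

-- Ordered-field arithmetic and finite sums.

module OrderedField (ℝ : Reals) where
  open Reals ℝ public
  open CommutativeRing commutativeRing public
    using ( refl; sym; trans; reflexive; setoid; ring; semiring; _-_; -‿cong
          ; +-cong; +-congˡ; +-congʳ; +-comm; +-assoc; +-identityˡ; +-identityʳ; -‿inverseʳ
          ; *-cong; *-congˡ; *-congʳ; *-comm; *-assoc; *-identityˡ; *-identityʳ
          ; distribˡ; zeroˡ; zeroʳ)
  open import Algebra.Properties.Ring ring public using (-‿+-comm; -0#≈0#; x∙y⁻¹≈ε⇒x≈y)
  open import Algebra.Properties.Semiring.Sum semiring public
    using (sum; sum-cong-≋; sum-remove; sum-replicate; sum-replicate-zero; ∑-distrib-+; ∑-comm
          ; *-distribˡ-sum; *-distribʳ-sum)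
  open DecTotalOrder decTotalOrder public using (poset; total)
    renaming ( refl to ≤-refl; trans to ≤-trans; antisym to ≤-antisym; reflexive to ≤-reflexive
             ; ≤-respˡ-≈ to ≤-respˡ-≈; ≤-respʳ-≈ to ≤-respʳ-≈)
  open IntegerSolver commutativeRing public

  x≤y⇒0≤y-x : ∀ {x y} → x ≤ y → 0# ≤ y - x
  x≤y⇒0≤y-x {x} x≤y = ≤-respˡ-≈ (-‿inverseʳ x) (+-monoˡ-≤ (- x) x≤y)

  0≤y-x⇒x≤y : ∀ {x y} → 0# ≤ y - x → x ≤ y
  0≤y-x⇒x≤y {x} {y} 0≤y-x =
    ≤-respˡ-≈ (+-identityˡ x) (≤-respʳ-≈ (solve 2 (λ x y → y :- x :+ x := y) refl x y) (+-monoˡ-≤ x 0≤y-x))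

  x≤0⇒0≤-x : ∀ {x} → x ≤ 0# → 0# ≤ - x
  x≤0⇒0≤-x x≤0 = ≤-respʳ-≈ (+-identityˡ _) (x≤y⇒0≤y-x x≤0)

  +-mono-≤ : ∀ {w x y z} → w ≤ x → y ≤ z → w + y ≤ x + z
  +-mono-≤ {w} {x} {y} {z} w≤x y≤z = ≤-trans (+-monoˡ-≤ y w≤x)
    (≤-respˡ-≈ (+-comm y x) (≤-respʳ-≈ (+-comm z x) (+-monoˡ-≤ x y≤z)))

  +-nonNegative : ∀ {x y} → 0# ≤ x → 0# ≤ y → 0# ≤ x + y
  +-nonNegative 0≤x 0≤y = ≤-respˡ-≈ (+-identityˡ 0#) (+-mono-≤ 0≤x 0≤y)

  *-monoˡ-≤ : ∀ {x y z} → 0# ≤ z → x ≤ y → z * x ≤ z * y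
  *-monoˡ-≤ {x} {y} {z} 0≤z x≤y = 0≤y-x⇒x≤y (≤-respʳ-≈
    (solve 3 (λ x y z → z :* (y :- x) := z :* y :- z :* x) refl x y z)
    (*-nonNegative 0≤z (x≤y⇒0≤y-x x≤y)))

  0≤x*x : ∀ x → 0# ≤ x * x
  0≤x*x x with total 0# x
  ... | inj₁ 0≤x = *-nonNegative 0≤x 0≤x
  ... | inj₂ x≤0 = ≤-respʳ-≈ (solve 1 (λ x → :- x :* :- x := x :* x) refl x)
                     (*-nonNegative (x≤0⇒0≤-x x≤0) (x≤0⇒0≤-x x≤0))

  0≤1 : 0# ≤ 1#
  0≤1 = ≤-respʳ-≈ (*-identityˡ 1#) (0≤x*x 1#)

  ⁻¹-inverseˡ : ∀ x → ¬ (x ≈ 0#) → x ⁻¹ * x ≈ 1#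
  ⁻¹-inverseˡ x x≉0 = trans (*-comm _ _) (⁻¹-inverseʳ x x≉0)

  x*y≈0⇒y≈0 : ∀ {x y} → ¬ (x ≈ 0#) → x * y ≈ 0# → y ≈ 0#
  x*y≈0⇒y≈0 {x} {y} x≉0 xy≈0 = begin
    y                ≈⟨ *-identityˡ y ⟨
    1# * y           ≈⟨ *-congʳ (⁻¹-inverseˡ x x≉0) ⟨
    x ⁻¹ * x * y     ≈⟨ *-assoc _ _ _ ⟩
    x ⁻¹ * (x * y)   ≈⟨ *-congˡ xy≈0 ⟩
    x ⁻¹ * 0#        ≈⟨ zeroʳ _ ⟩
    0#               ∎
    where open import Relation.Binary.Reasoning.Setoid setoid

  x*x≈0⇒x≈0 : ∀ {x} → x * x ≈ 0# → x ≈ 0#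
  x*x≈0⇒x≈0 {x} xx≈0 = decidable-stable (x ≟ 0#) λ x≉0 → x≉0 (x*y≈0⇒y≈0 x≉0 xx≈0)

  0≤x*y⇒0≤y : ∀ {x y} → 0# < x → 0# ≤ x * y → 0# ≤ y
  0≤x*y⇒0≤y {x} {y} (0≤x , 0≉x) 0≤xy with total 0# y
  ... | inj₁ 0≤y = 0≤y
  ... | inj₂ y≤0 = ≤-reflexive (sym (x*y≈0⇒y≈0 (0≉x ∘ sym) (≤-antisym xy≤0 0≤xy)))
    where
    xy≤0 : x * y ≤ 0#
    xy≤0 = ≤-respʳ-≈ (zeroʳ x) (*-monoˡ-≤ 0≤x y≤0)

  ⁻¹-nonNegative : ∀ {x} → 0# < x → 0# ≤ x ⁻¹
  ⁻¹-nonNegative 0<x@(_ , 0≉x) = 0≤x*y⇒0≤y 0<x (≤-respʳ-≈ (sym (⁻¹-inverseʳ _ (0≉x ∘ sym))) 0≤1)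

  fromℕ-mono-≤ : ∀ {m n} → m ℕ.≤ n → fromℕ m ≤ fromℕ n
  fromℕ-mono-≤ {n = zero}  z≤n       = ≤-refl
  fromℕ-mono-≤ {n = suc n} z≤n       = +-nonNegative 0≤1 (fromℕ-mono-≤ {n = n} z≤n)
  fromℕ-mono-≤             (s≤s m≤n) = +-mono-≤ ≤-refl (fromℕ-mono-≤ m≤n)

  sum-zero : ∀ {n} {f : Vector Carrier n} → (∀ i → f i ≈ 0#) → sum f ≈ 0#
  sum-zero {n} f≈0 = trans (sum-cong-≋ f≈0) (sum-replicate-zero n)

  sum-single : ∀ {n} i (f : Vector Carrier n) → (∀ j → j ≢ i → f j ≈ 0#) → sum f ≈ f i
  sum-single {suc n} i f f≈0 = trans (sum-remove {i = i} f)
    (trans (+-congˡ (sum-zero λ j → f≈0 (punchIn i j) (Fin.punchInᵢ≢i i j))) (+-identityʳ (f i)))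

  sum-neg : ∀ {n} (f : Vector Carrier n) → (sum λ i → - f i) ≈ - sum f
  sum-neg {zero}  f = sym -0#≈0#
  sum-neg {suc n} f = trans (+-congˡ (sum-neg (f ∘ suc))) (-‿+-comm _ _)

  sum-nonNegative : ∀ {n} {f : Vector Carrier n} → (∀ i → 0# ≤ f i) → 0# ≤ sum f
  sum-nonNegative {zero}  0≤f = ≤-refl
  sum-nonNegative {suc n} 0≤f = +-nonNegative (0≤f zero) (sum-nonNegative (0≤f ∘ suc))

  sum-mono-≤ : ∀ {n} {f g : Vector Carrier n} → (∀ i → f i ≤ g i) → sum f ≤ sum g
  sum-mono-≤ {zero}  f≤g = ≤-refl
  sum-mono-≤ {suc n} f≤g = +-mono-≤ (f≤g zero) (sum-mono-≤ (f≤g ∘ suc))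

  sum-↑ : ∀ m {n} (f : Vector Carrier (m ℕ.+ n)) → sum f ≈ (sum λ i → f (i ↑ˡ n)) + (sum λ j → f (m ↑ʳ j))
  sum-↑ zero    f = sym (+-identityˡ _)
  sum-↑ (suc m) f = trans (+-congˡ (sum-↑ m (f ∘ suc))) (sym (+-assoc _ _ _))

  sum-combine : ∀ m {n} (f : Vector Carrier (m ℕ.* n)) → sum f ≈ sum {m} λ i → sum {n} λ j → f (combine i j)
  sum-combine zero        f = refl
  sum-combine (suc m) {n} f = trans (sum-↑ n f) (+-congˡ (sum-combine m (f ∘ (n ↑ʳ_))))

  x+y≈0⇒x≈0 : ∀ {x y} → 0# ≤ x → 0# ≤ y → x + y ≈ 0# → x ≈ 0#
  x+y≈0⇒x≈0 {x} {y} 0≤x 0≤y x+y≈0 = ≤-antisym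
    (≤-respˡ-≈ (+-identityʳ x) (≤-respʳ-≈ x+y≈0 (+-mono-≤ ≤-refl 0≤y))) 0≤x

  sum≈0⇒≈0 : ∀ {n} {f : Vector Carrier n} → (∀ i → 0# ≤ f i) → sum f ≈ 0# → ∀ i → f i ≈ 0#
  sum≈0⇒≈0 0≤f ∑f≈0 zero    = x+y≈0⇒x≈0 (0≤f zero) (sum-nonNegative (0≤f ∘ suc)) ∑f≈0
  sum≈0⇒≈0 0≤f ∑f≈0 (suc i) = sum≈0⇒≈0 (0≤f ∘ suc)
    (x+y≈0⇒x≈0 (sum-nonNegative (0≤f ∘ suc)) (0≤f zero) (trans (+-comm _ _) ∑f≈0)) i

  -- Cauchy-Schwarz against the all-ones vector, from the variance identity Σₖ (N tₖ - s)² = N (N q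
  -- - s²). Deviations from the mean are scaled by N to stay free of division; the nonempty index
  -- set makes N positive, so N can be cancelled.
  sum-square-≤ : ∀ {n} (t : Vector Carrier (suc n)) →
                 sum t * sum t ≤ fromℕ (suc n) * sum λ k → t k * t k
  sum-square-≤ {n} t = 0≤y-x⇒x≤y (0≤x*y⇒0≤y 0<N (≤-respʳ-≈ identity (sum-nonNegative λ k → 0≤x*x (N * t k - s))))
    where
    open import Relation.Binary.Reasoning.Setoid setoid
    N s q : Carrier
    N = fromℕ (suc n)
    s = sum t
    q = sum λ k → t k * t k

    0<N : 0# < N
    0<N = fromℕ-mono-≤ {n = suc n} z≤n , λ 0≈N →
      1≉0 (x+y≈0⇒x≈0 0≤1 (fromℕ-mono-≤ {n = n} z≤n) (sym 0≈N))

    identity : (sum λ k → (N * t k - s) * (N * t k - s)) ≈ N * (N * q - s * s)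
    identity = begin
      (sum λ k → (N * t k - s) * (N * t k - s))
        ≈⟨ sum-cong-≋ (λ k → solve 3 (λ N t s → (N :* t :- s) :* (N :* t :- s) :=
             N :* N :* (t :* t) :+ :- (N :* s :+ N :* s) :* t :+ s :* s) refl N (t k) s) ⟩
      (sum λ k → N * N * (t k * t k) + - (N * s + N * s) * t k + s * s)
        ≈⟨ trans (∑-distrib-+ (λ k → N * N * (t k * t k) + - (N * s + N * s) * t k) (λ _ → s * s))
                 (+-congʳ (∑-distrib-+ (λ k → N * N * (t k * t k)) (λ k → - (N * s + N * s) * t k))) ⟩
      (sum λ k → N * N * (t k * t k)) + (sum λ k → - (N * s + N * s) * t k) + (sum λ (_ : Fin (suc n)) → s * s)
        ≈⟨ +-cong (+-cong (sym (*-distribˡ-sum (N * N) (λ k → t k * t k))) (sym (*-distribˡ-sum (- (N * s + N * s)) t)))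
             (sum-const (s * s)) ⟩
      N * N * q + - (N * s + N * s) * s + N * (s * s)
        ≈⟨ solve 3 (λ N q s → N :* N :* q :+ :- (N :* s :+ N :* s) :* s :+ N :* (s :* s) :=
             N :* (N :* q :- s :* s)) refl N q s ⟩
      N * (N * q - s * s) ∎
      where
      sum-const : ∀ x → (sum λ (_ : Fin (suc n)) → x) ≈ N * x
      sum-const x = sym (trans (*-comm _ _) (trans (*-congˡ (sym (sum-replicate (suc n))))
        (trans (*-distribˡ-sum x (λ (_ : Fin (suc n)) → 1#)) (sum-cong-≋ {suc n} λ _ → *-identityʳ x))))

-- Counting the indices that satisfy a decidable predicate.

count : ∀ {n} {Q : Fin n → Set} → Decidable Q → ℕ
count {zero}  Q? = 0
count {suc n} Q? = (if does (Q? zero) then suc else id) (count (Q? ∘ suc))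

-- Multiplicities in `IsSpectrum` count values. `count` lets the predicate depend on the index as
-- well, as needed to speak of the earlier occurrences of a value.
count≡Vec-count : ∀ {A : Set} {P : A → Set} (P? : Decidable P) {n} (f : Vector A n) →
                  Vec.count P? (Vec.tabulate f) ≡ count (P? ∘ f)
count≡Vec-count P? {zero}  f = ≡.refl
count≡Vec-count P? {suc n} f with does (P? (f zero))
... | true  = ≡.cong suc (count≡Vec-count P? (f ∘ suc))
... | false = count≡Vec-count P? (f ∘ suc)

count≤n : ∀ {n} {Q : Fin n → Set} (Q? : Decidable Q) → count Q? ℕ.≤ n
count≤n {zero}  Q? = z≤n
count≤n {suc n} Q? with does (Q? zero)
... | true  = s≤s (count≤n (Q? ∘ suc))
... | false = ℕ.m≤n⇒m≤1+n (count≤n (Q? ∘ suc))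

count-mono-≤ : ∀ {n} {P Q : Fin n → Set} (P? : Decidable P) (Q? : Decidable Q) →
               (∀ i → P i → Q i) → count P? ℕ.≤ count Q?
count-mono-≤ {zero}  P? Q? P⇒Q = z≤n
count-mono-≤ {suc n} P? Q? P⇒Q with P? zero | Q? zero
... | yes p | yes q = s≤s (count-mono-≤ (P? ∘ suc) (Q? ∘ suc) (P⇒Q ∘ suc))
... | yes p | no ¬q = contradiction (P⇒Q zero p) ¬q
... | no ¬p | yes q = ℕ.m≤n⇒m≤1+n (count-mono-≤ (P? ∘ suc) (Q? ∘ suc) (P⇒Q ∘ suc))
... | no ¬p | no ¬q = count-mono-≤ (P? ∘ suc) (Q? ∘ suc) (P⇒Q ∘ suc)

count-mono-< : ∀ {n} {P Q : Fin n → Set} (P? : Decidable P) (Q? : Decidable Q) →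
               (∀ i → P i → Q i) → ∀ i → ¬ P i → Q i → count P? ℕ.< count Q?
count-mono-< {suc n} P? Q? P⇒Q zero ¬p q with P? zero | Q? zero
... | yes p | _     = contradiction p ¬p
... | no _  | yes _ = s≤s (count-mono-≤ (P? ∘ suc) (Q? ∘ suc) (P⇒Q ∘ suc))
... | no _  | no ¬q = contradiction q ¬q
count-mono-< {suc n} P? Q? P⇒Q (suc i) ¬p q with P? zero | Q? zero
... | yes _ | yes _  = s≤s (count-mono-< (P? ∘ suc) (Q? ∘ suc) (P⇒Q ∘ suc) i ¬p q)
... | yes p | no ¬q₀ = contradiction (P⇒Q zero p) ¬q₀
... | no _  | yes _  = ℕ.m≤n⇒m≤1+n (count-mono-< (P? ∘ suc) (Q? ∘ suc) (P⇒Q ∘ suc) i ¬p q)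
... | no _  | no _   = count-mono-< (P? ∘ suc) (Q? ∘ suc) (P⇒Q ∘ suc) i ¬p q

-- Dot products and homogeneous linear systems.

module RealLinearAlgebra (ℝ : Reals) where
  open OrderedField ℝ public
  open Spectrum ℝ public
  open import Relation.Binary.Reasoning.Setoid setoid

  infix 8 _∙_

  _∙_ : ∀ {n} → Vector Carrier n → Vector Carrier n → Carrier
  u ∙ v = sum λ i → u i * v i

  ∙-cong : ∀ {n} {u u′ v v′ : Vector Carrier n} → u ≋ u′ → v ≋ v′ → u ∙ v ≈ u′ ∙ v′
  ∙-cong u≋u′ v≋v′ = sum-cong-≋ λ i → *-cong (u≋u′ i) (v≋v′ i)

  ∙-congˡ : ∀ {n} (u : Vector Carrier n) {v v′} → v ≋ v′ → u ∙ v ≈ u ∙ v′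
  ∙-congˡ u = ∙-cong {u = u} (λ _ → refl)

  ∙-congʳ : ∀ {n} {u u′} (v : Vector Carrier n) → u ≋ u′ → u ∙ v ≈ u′ ∙ v
  ∙-congʳ v u≋u′ = ∙-cong {v = v} u≋u′ (λ _ → refl)

  ∙-comm : ∀ {n} (u v : Vector Carrier n) → u ∙ v ≈ v ∙ u
  ∙-comm u v = sum-cong-≋ λ i → *-comm (u i) (v i)

  ∙-zeroʳ : ∀ {n} (u : Vector Carrier n) {v} → v ≋ 0ⱽ → u ∙ v ≈ 0#
  ∙-zeroʳ u v≋0 = sum-zero λ i → trans (*-congˡ (v≋0 i)) (zeroʳ (u i))

  ∙-scaleʳ : ∀ {n} a (u v : Vector Carrier n) → u ∙ (a • v) ≈ a * u ∙ v
  ∙-scaleʳ a u v = begin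
    u ∙ (a • v)                     ≈⟨ sum-cong-≋ (λ i → solve 3 (λ a x y → x :* (a :* y) := a :* (x :* y)) refl a (u i) (v i)) ⟩
    (sum λ i → a * (u i * v i))     ≈⟨ *-distribˡ-sum a (λ i → u i * v i) ⟨
    a * u ∙ v                       ∎

  ∙-+ʳ : ∀ {n} (u v w : Vector Carrier n) → (u ∙ λ i → v i + w i) ≈ u ∙ v + u ∙ w
  ∙-+ʳ u v w = trans (sum-cong-≋ λ i → distribˡ (u i) (v i) (w i)) (∑-distrib-+ (λ i → u i * v i) (λ i → u i * w i))

  ∙-sumʳ : ∀ {k n} (u : Vector Carrier n) (w : Vector (Vector Carrier n) k) →
           (u ∙ λ i → sum λ l → w l i) ≈ sum λ l → u ∙ w l
  ∙-sumʳ u w = begin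
    (u ∙ λ i → sum λ l → w l i)         ≈⟨ sum-cong-≋ (λ i → *-distribˡ-sum (u i) (λ l → w l i)) ⟩
    (sum λ i → sum λ l → u i * w l i)   ≈⟨ ∑-comm (λ i l → u i * w l i) ⟩
    (sum λ l → u ∙ w l)                 ∎

  ∙-linearCombination : ∀ {k n} (u : Vector Carrier n) a (b : Vector (Vector Carrier n) k) →
                        u ∙ linearCombination a b ≈ sum λ l → a l * u ∙ b l
  ∙-linearCombination u a b = begin
    u ∙ linearCombination a b     ≈⟨ ∙-sumʳ u (λ l → a l • b l) ⟩
    (sum λ l → u ∙ (a l • b l))   ≈⟨ sum-cong-≋ (λ l → ∙-scaleʳ (a l) u (b l)) ⟩
    (sum λ l → a l * u ∙ b l)     ∎

  0≤u∙u : ∀ {n} (u : Vector Carrier n) → 0# ≤ u ∙ u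
  0≤u∙u u = sum-nonNegative λ i → 0≤x*x (u i)

  u∙u≈0⇒u≋0 : ∀ {n} (u : Vector Carrier n) → u ∙ u ≈ 0# → u ≋ 0ⱽ
  u∙u≈0⇒u≋0 u uu≈0 i = x*x≈0⇒x≈0 (sum≈0⇒≈0 (λ i → 0≤x*x (u i)) uu≈0 i)

  u≉0⇒0<u∙u : ∀ {n} {u : Vector Carrier n} → ¬ (u ≋ 0ⱽ) → 0# < u ∙ u
  u≉0⇒0<u∙u {u = u} u≉0 = 0≤u∙u u , λ 0≈uu → u≉0 (u∙u≈0⇒u≋0 u (sym 0≈uu))

  ∙-insertAt : ∀ {n} (u : Vector Carrier (suc n)) (a : Vector Carrier n) p x →
               u ∙ insertAt a p x ≈ u p * x + (u ∘ punchIn p) ∙ a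
  ∙-insertAt u a p x = begin
    u ∙ insertAt a p x                  ≈⟨ sum-remove {i = p} (λ i → u i * insertAt a p x i) ⟩
    u p * insertAt a p x p + (u ∘ punchIn p) ∙ (insertAt a p x ∘ punchIn p)
      ≈⟨ +-cong (*-congˡ (reflexive (Vector.insertAt-lookup a p x)))
                (∙-congˡ (u ∘ punchIn p) (λ i → reflexive (Vector.insertAt-punchIn a p x i))) ⟩
    u p * x + (u ∘ punchIn p) ∙ a       ∎

  -- Gaussian elimination by induction on the rows. Only rows selected by `Q?` are equations, so
  -- their number can be compared with a multiplicity. Nontriviality comes as a nonzero coordinate,
  -- ready to contradict linear independence.
  kernel : ∀ {m n} (M : Matrix m n) {Q : Fin m → Set} (Q? : Decidable Q) → count Q? ℕ.< n →
           ∃ λ a → (∃ λ i → ¬ (a i ≈ 0#)) × (∀ i → Q i → M i ∙ a ≈ 0#)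
  kernel {zero}  {suc n} M Q? _ = (λ _ → 1#) , (zero , 1≉0) , λ ()
  kernel {suc m} {n} M {Q} Q? count<n with Q? zero
  kernel {suc m} {n} M {Q} Q? count<n | no ¬q
    with a , a≉0 , Ma≈0 ← kernel (M ∘ suc) (Q? ∘ suc) count<n =
    a , a≉0 , λ { zero q → contradiction q ¬q ; (suc i) → Ma≈0 i }
  kernel {suc m} {suc n} M {Q} Q? (s≤s count<n) | yes _
    with Fin.any? (λ p → ¬? (M zero p ≟ 0#))
  ... | no  M₀≈0
    with a , a≉0 , Ma≈0 ← kernel (M ∘ suc) (Q? ∘ suc) (ℕ.m<n⇒m<1+n count<n) =
    a , a≉0 ,
    λ { zero _ → trans (∙-comm (M zero) a)
          (∙-zeroʳ a λ p → decidable-stable (M zero p ≟ 0#) λ M₀p≉0 → M₀≈0 (p , M₀p≉0))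
      ; (suc i) → Ma≈0 i }
  -- With a pivot at `p`, the remaining rows are replaced by their Schur complement, and `x` is the
  -- value that row `zero` forces on coordinate `p`. One equation and one unknown disappear
  -- together.
  ... | yes (p , rp≉0)
    with a , (j , aj≉0) , M′a≈0 ← kernel {m} {n}
           (λ i j → M (suc i) (punchIn p j) - M (suc i) p * (M zero p ⁻¹ * M zero (punchIn p j)))
           (Q? ∘ suc) count<n =
    insertAt a p x ,
    (punchIn p j , λ eq → aj≉0 (trans (reflexive (≡.sym (Vector.insertAt-punchIn a p x j))) eq)) ,
    λ { zero _ → M₀a≈0 ; (suc i) q → trans (Mᵢa≈M′ᵢa i) (M′a≈0 i q) }
    where
    r r′ : Vector Carrier _
    r = M zero
    r′ = r ∘ punchIn p
    x : Carrier
    x = - (r p ⁻¹ * r′ ∙ a)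

    M₀a≈0 : r ∙ insertAt a p x ≈ 0#
    M₀a≈0 = begin
      r ∙ insertAt a p x                           ≈⟨ ∙-insertAt r a p x ⟩
      r p * x + r′ ∙ a
        ≈⟨ solve 3 (λ r s d → r :* :- (s :* d) :+ d := d :- r :* s :* d) refl (r p) (r p ⁻¹) (r′ ∙ a) ⟩
      r′ ∙ a - r p * r p ⁻¹ * r′ ∙ a               ≈⟨ +-congˡ (-‿cong (trans (*-congʳ (⁻¹-inverseʳ (r p) rp≉0)) (*-identityˡ _))) ⟩
      r′ ∙ a - r′ ∙ a                              ≈⟨ -‿inverseʳ _ ⟩
      0#                                           ∎

    Mᵢa≈M′ᵢa : ∀ i → M (suc i) ∙ insertAt a p x ≈
                     sum λ j → (M (suc i) (punchIn p j) - M (suc i) p * (M zero p ⁻¹ * M zero (punchIn p j))) * a j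
    Mᵢa≈M′ᵢa i = begin
      R ∙ insertAt a p x                           ≈⟨ ∙-insertAt R a p x ⟩
      R p * x + (R ∘ punchIn p) ∙ a
        ≈⟨ solve 4 (λ R s d e → R :* :- (s :* d) :+ e := e :+ :- (R :* s) :* d) refl
             (R p) (r p ⁻¹) (r′ ∙ a) ((R ∘ punchIn p) ∙ a) ⟩
      (R ∘ punchIn p) ∙ a + - (R p * r p ⁻¹) * r′ ∙ a
        ≈⟨ +-congˡ (*-distribˡ-sum (- (R p * r p ⁻¹)) (λ j → r′ j * a j)) ⟩
      (R ∘ punchIn p) ∙ a + (sum λ j → - (R p * r p ⁻¹) * (r′ j * a j))
        ≈⟨ ∑-distrib-+ (λ j → R (punchIn p j) * a j) (λ j → - (R p * r p ⁻¹) * (r′ j * a j)) ⟨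
      (sum λ j → R (punchIn p j) * a j + - (R p * r p ⁻¹) * (r′ j * a j))
        ≈⟨ sum-cong-≋ (λ j → solve 5 (λ R′ R s r a → R′ :* a :+ :- (R :* s) :* (r :* a) := (R′ :- R :* (s :* r)) :* a) refl
             (R (punchIn p j)) (R p) (r p ⁻¹) (r′ j) (a j)) ⟩
      (sum λ j → (R (punchIn p j) - R p * (r p ⁻¹ * r′ j)) * a j)  ∎
      where
      R : Vector Carrier _
      R = M (suc i)

-- Orthogonal eigenbases of symmetric matrices and the spectral form of x I - A.

module SymmetricMatrices (ℝ : Reals) where
  open RealLinearAlgebra ℝ public
  open import Relation.Binary.Reasoning.Setoid setoid

  module SymmetricMatrix {n : ℕ} (A : Matrix n n) (A-sym : ∀ i j → A i j ≈ A j i) where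

    *ⱽ-selfAdjoint : ∀ u v → u ∙ (A *ⱽ v) ≈ (A *ⱽ u) ∙ v
    *ⱽ-selfAdjoint u v = begin
      u ∙ (A *ⱽ v)                                  ≈⟨ ∙-sumʳ u (λ j i → A i j * v j) ⟩
      (sum λ j → u ∙ λ i → A i j * v j)             ≈⟨ sum-cong-≋ (λ j → sum-cong-≋ (λ i →
        trans (*-congˡ (*-congʳ (A-sym i j))) (solve 3 (λ u a v → u :* (a :* v) := a :* u :* v) refl (u i) (A j i) (v j)))) ⟩
      (sum λ j → sum λ i → A j i * u i * v j)       ≈⟨ sum-cong-≋ (λ j → *-distribʳ-sum (v j) (λ i → A j i * u i)) ⟨
      (A *ⱽ u) ∙ v                                  ∎

    -- Self-adjointness makes (x - y)⟨u, v⟩ vanish, and x - y can be cancelled.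
    eigenvectors-orthogonal : ∀ {x y u v} → Eigenspace A x u → Eigenspace A y v → ¬ (x ≈ y) → u ∙ v ≈ 0#
    eigenvectors-orthogonal {x} {y} {u} {v} Au≋xu Av≋yv x≉y =
      x*y≈0⇒y≈0 (x≉y ∘ x∙y⁻¹≈ε⇒x≈y x y) (begin
        (x - y) * u ∙ v                ≈⟨ solve 3 (λ x y d → (x :- y) :* d := x :* d :- y :* d) refl x y (u ∙ v) ⟩
        x * u ∙ v - y * u ∙ v
          ≈⟨ +-cong (trans (*-congˡ (∙-comm u v)) (sym (∙-scaleʳ x v u))) (-‿cong (sym (∙-scaleʳ y u v))) ⟩
        v ∙ (x • u) - u ∙ (y • v)      ≈⟨ +-cong (∙-congˡ v Au≋xu) (-‿cong (∙-congˡ u Av≋yv)) ⟨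
        v ∙ (A *ⱽ u) - u ∙ (A *ⱽ v)    ≈⟨ +-congʳ (trans (∙-comm v (A *ⱽ u)) (sym (*ⱽ-selfAdjoint u v))) ⟩
        u ∙ (A *ⱽ v) - u ∙ (A *ⱽ v)    ≈⟨ -‿inverseʳ _ ⟩
        0#                             ∎)

    linearCombination-eigenspace : ∀ {x k} a {b : Vector (Vector Carrier n) k} → (∀ l → Eigenspace A x (b l)) →
                                   Eigenspace A x (linearCombination a b)
    linearCombination-eigenspace {x} a {b} Ab≋xb i = begin
      A i ∙ linearCombination a b         ≈⟨ ∙-linearCombination (A i) a b ⟩
      (sum λ l → a l * A i ∙ b l)         ≈⟨ sum-cong-≋ (λ l → trans (*-congˡ (Ab≋xb l i))
                                               (solve 3 (λ a x b → a :* (x :* b) := x :* (a :* b)) refl (a l) x (b l i))) ⟩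
      (sum λ l → x * (a l * b l i))       ≈⟨ *-distribˡ-sum x (λ l → a l * b l i) ⟨
      x * linearCombination a b i         ∎

    -- A partial eigenbasis. Entries from index `k` on are unconstrained placeholders, so an
    -- extension overwrites one entry without changing the type of `b`. Vector `b i` belongs to
    -- `μ i`, which keeps the order of the spectrum; lengths are left arbitrary.
    record OrthogonalEigenvectors (μ : Vector Carrier n) (k : ℕ) : Set where
      field
        b           : Vector (Vector Carrier n) n
        nonzero     : ∀ i → Fin.toℕ i ℕ.< k → ¬ (b i ≋ 0ⱽ)
        eigenvector : ∀ i → Fin.toℕ i ℕ.< k → Eigenspace A (μ i) (b i)
        orthogonal  : ∀ i j → Fin.toℕ j ℕ.< k → Fin.toℕ i ℕ.< Fin.toℕ j → b i ∙ b j ≈ 0#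

    module _ {μ : Vector Carrier n} (multiplicity : ∀ x → HasMultiplicity A x (Vec.count (_≟ x) (Vec.tabulate μ))) where

      -- The index `κ` carries the value `μ κ` but is not among the first `k`, so the inclusion of
      -- the counted sets is strict.
      count-previous : ∀ {k} κ → k ℕ.≤ Fin.toℕ κ →
                       count (λ i → (Fin.toℕ i ℕ.<? k) ×-dec (μ i ≟ μ κ)) ℕ.< Vec.count (_≟ μ κ) (Vec.tabulate μ)
      count-previous {k} κ k≤κ = ≡.subst (count previous? ℕ.<_) (≡.sym (count≡Vec-count (_≟ μ κ) μ))
        (count-mono-< previous? (λ i → μ i ≟ μ κ) (λ _ → proj₂) κ (λ (κ<k , _) → ℕ.<⇒≱ κ<k k≤κ) refl)
        where
        previous? : Decidable λ i → (Fin.toℕ i ℕ.< k) × (μ i ≈ μ κ)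
        previous? i = (Fin.toℕ i ℕ.<? k) ×-dec (μ i ≟ μ κ)

      -- Fewer than mult(μ κ) of the previous vectors belong to the eigenvalue μ κ,
      -- so its eigenspace contains a nonzero vector orthogonal to all of those.
      newEigenvector : ∀ {k} (bs : OrthogonalEigenvectors μ k) κ → k ℕ.≤ Fin.toℕ κ → let open OrthogonalEigenvectors bs in
                       ∃ λ v → ¬ (v ≋ 0ⱽ) × Eigenspace A (μ κ) v × (∀ i → Fin.toℕ i ℕ.< k → b i ∙ v ≈ 0#)
      newEigenvector {k} bs κ k≤κ
        with β , Aβ≋μβ , independent , _ ← multiplicity (μ κ)
        with a , (l , al≉0) , ⊥-b ← kernel (λ i l → OrthogonalEigenvectors.b bs i ∙ β l)
               (λ i → (Fin.toℕ i ℕ.<? k) ×-dec (μ i ≟ μ κ))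
               (count-previous κ k≤κ) =
        v , (λ v≋0 → al≉0 (independent a v≋0 l)) , Av≋μv , v⊥b
        where
        open OrthogonalEigenvectors bs
        v : Vector Carrier n
        v = linearCombination a β

        Av≋μv : Eigenspace A (μ κ) v
        Av≋μv = linearCombination-eigenspace a Aβ≋μβ

        v⊥b : ∀ i → Fin.toℕ i ℕ.< k → b i ∙ v ≈ 0#
        v⊥b i i<k with μ i ≟ μ κ
        -- Earlier vectors of other eigenvalues were not imposed as equations: distinctness already
        -- makes them orthogonal to `v`.
        ... | no μi≉μκ  = eigenvectors-orthogonal (eigenvector i i<k) Av≋μv μi≉μκ
        ... | yes μi≈μκ = trans (∙-linearCombination (b i) a β)
          (trans (sum-cong-≋ λ l → *-comm (a l) (b i ∙ β l)) (⊥-b i (i<k , μi≈μκ)))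

      -- Greedy extension: each step fills the entry `κ` of index `k` with an eigenvector for `μ κ`.
      -- Taken up to `n` it yields an orthogonal basis.
      orthogonalEigenvectors : ∀ k → k ℕ.≤ n → OrthogonalEigenvectors μ k
      orthogonalEigenvectors zero _ = record
        { b = λ _ → 0ⱽ ; nonzero = λ _ () ; eigenvector = λ _ () ; orthogonal = λ _ _ () }
      orthogonalEigenvectors (suc k) k<n = extend (newEigenvector bs κ (ℕ.≤-reflexive (≡.sym κ≡k)))
        where
        κ : Fin n
        κ = Fin.fromℕ< k<n
        κ≡k : Fin.toℕ κ ≡ k
        κ≡k = Fin.toℕ-fromℕ< k<n
        bs : OrthogonalEigenvectors μ k
        bs = orthogonalEigenvectors k (ℕ.<⇒≤ k<n)
        open OrthogonalEigenvectors bs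

        <k : ∀ {i} → Fin.toℕ i ℕ.< suc k → i ≢ κ → Fin.toℕ i ℕ.< k
        <k (s≤s i≤k) i≢κ = ℕ.≤∧≢⇒< i≤k (λ i≡k → i≢κ (Fin.toℕ-injective (≡.trans i≡k (≡.sym κ≡k))))

        extend : (∃ λ v → ¬ (v ≋ 0ⱽ) × Eigenspace A (μ κ) v × (∀ i → Fin.toℕ i ℕ.< k → b i ∙ v ≈ 0#)) →
                 OrthogonalEigenvectors μ (suc k)
        extend (v , v≉0 , Av≋μv , v⊥b) = record
          { b = b′ ; nonzero = nonzero′ ; eigenvector = eigenvector′ ; orthogonal = orthogonal′ }
          where
          b′ : Vector (Vector Carrier n) n
          b′ i with i Fin.≟ κ
          ... | yes _ = v
          ... | no  _ = b i

          nonzero′ : ∀ i → Fin.toℕ i ℕ.< suc k → ¬ (b′ i ≋ 0ⱽ)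
          nonzero′ i i≤k with i Fin.≟ κ
          ... | yes _   = v≉0
          ... | no  i≢κ = nonzero i (<k i≤k i≢κ)

          eigenvector′ : ∀ i → Fin.toℕ i ℕ.< suc k → Eigenspace A (μ i) (b′ i)
          eigenvector′ i i≤k with i Fin.≟ κ
          ... | yes ≡.refl = Av≋μv
          ... | no  i≢κ    = eigenvector i (<k i≤k i≢κ)

          orthogonal′ : ∀ i j → Fin.toℕ j ℕ.< suc k → Fin.toℕ i ℕ.< Fin.toℕ j → b′ i ∙ b′ j ≈ 0#
          orthogonal′ i j j≤k i<j with i Fin.≟ κ | j Fin.≟ κ
          -- `κ` is the last index filled so far and hence precedes no `j` in range.
          ... | yes ≡.refl | _          = contradiction (ℕ.≤-trans i<j (ℕ.s≤s⁻¹ j≤k)) (ℕ.≤⇒≯ (ℕ.≤-reflexive (≡.sym κ≡k)))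
          ... | no _       | yes ≡.refl = v⊥b i (ℕ.<-≤-trans i<j (ℕ.≤-reflexive κ≡k))
          ... | no _       | no j≢κ     = orthogonal i j (<k j≤k j≢κ) i<j

    module _ {μ : Vector Carrier n} (bs : OrthogonalEigenvectors μ n) where
      open OrthogonalEigenvectors bs

      ⊥-b : ∀ {i j} → i ≢ j → b i ∙ b j ≈ 0#
      ⊥-b {i} {j} i≢j with Fin.<-cmp i j
      ... | tri< i<j _ _   = orthogonal i j (Fin.toℕ<n j) i<j
      ... | tri≈ _ i≡j _   = contradiction i≡j i≢j
      ... | tri> _ _ j<i   = trans (∙-comm (b i) (b j)) (orthogonal j i (Fin.toℕ<n i) j<i)

      0<b∙b : ∀ i → 0# < b i ∙ b i
      0<b∙b i = u≉0⇒0<u∙u (nonzero i (Fin.toℕ<n i))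

      b∙-linearCombination : ∀ i a → b i ∙ linearCombination a b ≈ a i * b i ∙ b i
      b∙-linearCombination i a = begin
        b i ∙ linearCombination a b                ≈⟨ ∙-linearCombination (b i) a b ⟩
        (sum λ l → a l * b i ∙ b l)
          ≈⟨ sum-single i (λ l → a l * b i ∙ b l) (λ l l≢i → trans (*-congˡ (⊥-b (l≢i ∘ ≡.sym))) (zeroʳ _)) ⟩
        a i * b i ∙ b i                            ∎

      -- A kernel vector of the matrix with the n + 1 columns z, b₀, …, bₙ₋₁ has to
      -- be supported on z.
      ⊥-all⇒≋0 : ∀ z → (∀ i → b i ∙ z ≈ 0#) → z ≋ 0ⱽ
      ⊥-all⇒≋0 z b⊥z
        with a , (j , aj≉0) , dependent ← kernel (λ v → z v ∷ λ i → b i v) {Q = λ _ → ⊤} (λ _ → yes tt)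
               (s≤s (count≤n {Q = λ _ → ⊤} (λ _ → yes tt))) = λ v →
        x*y≈0⇒y≈0 (a₀≉0 j aj≉0) (begin
          a zero * z v                          ≈⟨ +-identityʳ _ ⟨
          a zero * z v + 0#                     ≈⟨ +-cong (*-comm _ _) (sym (sum-zero λ i → trans (*-congˡ (aᵢ≈0 i)) (zeroʳ _))) ⟩
          z v * a zero + (sum λ i → b i v * a (suc i))  ≈⟨ dependent v _ ⟩
          0#                                    ∎)
        where
        a′ : Vector Carrier n
        a′ = a ∘ suc

        aᵢ≈0 : ∀ i → a (suc i) ≈ 0#
        aᵢ≈0 i = x*y≈0⇒y≈0 (proj₂ (0<b∙b i) ∘ sym) (begin
          b i ∙ b i * a′ i                                  ≈⟨ *-comm _ _ ⟩
          a′ i * b i ∙ b i                                  ≈⟨ b∙-linearCombination i a′ ⟨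
          b i ∙ linearCombination a′ b                      ≈⟨ +-identityˡ _ ⟨
          0# + b i ∙ linearCombination a′ b
            ≈⟨ +-congʳ (trans (∙-scaleʳ (a zero) (b i) z) (trans (*-congˡ (b⊥z i)) (zeroʳ _))) ⟨
          b i ∙ (a zero • z) + b i ∙ linearCombination a′ b ≈⟨ ∙-+ʳ (b i) (a zero • z) (linearCombination a′ b) ⟨
          (b i ∙ λ v → a zero * z v + linearCombination a′ b v)
            ≈⟨ ∙-zeroʳ (b i) (λ v → trans (+-cong (*-comm _ _) (sum-cong-≋ λ i → *-comm (a′ i) (b i v))) (dependent v _)) ⟩
          0#                                                ∎)

        a₀≉0 : ∀ j → ¬ (a j ≈ 0#) → ¬ (a zero ≈ 0#)
        a₀≉0 zero    a₀≉0 = a₀≉0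
        a₀≉0 (suc i) aᵢ≉0 = contradiction (aᵢ≈0 i) aᵢ≉0

      -- Compensates for the missing normalisation: `weight i * b i ∙ y` is the coordinate of `y`
      -- along `b i`.
      weight : Fin n → Carrier
      weight i = (b i ∙ b i) ⁻¹

      0≤weight : ∀ i → 0# ≤ weight i
      0≤weight i = ⁻¹-nonNegative (0<b∙b i)

      -- The residual is orthogonal to every `b i`, hence zero by `⊥-all⇒≋0`.
      expansion : ∀ y → y ≋ linearCombination (λ i → weight i * b i ∙ y) b
      expansion y v = x∙y⁻¹≈ε⇒x≈y (y v) _ (⊥-all⇒≋0 (λ v → y v - linearCombination coeff b v) residual⊥b v)
        where
        coeff : Vector Carrier n
        coeff i = weight i * b i ∙ y

        residual⊥b : ∀ i → (b i ∙ λ v → y v - linearCombination coeff b v) ≈ 0#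
        residual⊥b i = begin
          (b i ∙ λ v → y v - linearCombination coeff b v)
            ≈⟨ ∙-congˡ (b i) (λ v → +-congˡ (solve 1 (λ x → :- x := :- con (ℤ.+ 1) :* x) refl (linearCombination coeff b v))) ⟩
          (b i ∙ λ v → y v + - 1# * linearCombination coeff b v)
            ≈⟨ ∙-+ʳ (b i) y (- 1# • linearCombination coeff b) ⟩
          b i ∙ y + b i ∙ (- 1# • linearCombination coeff b)
            ≈⟨ +-congˡ (trans (∙-scaleʳ (- 1#) (b i) (linearCombination coeff b)) (*-congˡ (b∙-linearCombination i coeff))) ⟩
          b i ∙ y + - 1# * (weight i * b i ∙ y * b i ∙ b i)
            ≈⟨ solve 3 (λ y w q → y :+ :- con (ℤ.+ 1) :* (w :* y :* q) := y :- w :* q :* y) refl (b i ∙ y) (weight i) (b i ∙ b i) ⟩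
          b i ∙ y - weight i * b i ∙ b i * b i ∙ y
            ≈⟨ +-congˡ (-‿cong (trans (*-congʳ (⁻¹-inverseˡ _ (proj₂ (0<b∙b i) ∘ sym))) (*-identityˡ _))) ⟩
          b i ∙ y - b i ∙ y
            ≈⟨ -‿inverseʳ _ ⟩
          0# ∎

      parseval : ∀ x y → x ∙ y ≈ sum λ i → weight i * (b i ∙ x * b i ∙ y)
      parseval x y = begin
        x ∙ y                                              ≈⟨ ∙-congˡ x (expansion y) ⟩
        x ∙ linearCombination (λ i → weight i * b i ∙ y) b ≈⟨ ∙-linearCombination x _ b ⟩
        (sum λ i → weight i * b i ∙ y * x ∙ b i)           ≈⟨ sum-cong-≋ (λ i → trans (*-congˡ (∙-comm x (b i)))
          (solve 3 (λ w y x → w :* y :* x := w :* (x :* y)) refl (weight i) (b i ∙ y) (b i ∙ x))) ⟩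
        (sum λ i → weight i * (b i ∙ x * b i ∙ y))         ∎

      parseval-A : ∀ y → y ∙ (A *ⱽ y) ≈ sum λ i → μ i * (weight i * (b i ∙ y * b i ∙ y))
      parseval-A y = begin
        y ∙ (A *ⱽ y)                                       ≈⟨ parseval y (A *ⱽ y) ⟩
        (sum λ i → weight i * (b i ∙ y * b i ∙ (A *ⱽ y)))  ≈⟨ sum-cong-≋ (λ i → trans (*-congˡ (*-congˡ (b∙Ay i)))
          (solve 3 (λ w t m → w :* (t :* (m :* t)) := m :* (w :* (t :* t))) refl (weight i) (b i ∙ y) (μ i))) ⟩
        (sum λ i → μ i * (weight i * (b i ∙ y * b i ∙ y))) ∎
        where
        b∙Ay : ∀ i → b i ∙ (A *ⱽ y) ≈ μ i * b i ∙ y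
        b∙Ay i = begin
          b i ∙ (A *ⱽ y)   ≈⟨ *ⱽ-selfAdjoint (b i) y ⟩
          (A *ⱽ b i) ∙ y   ≈⟨ ∙-comm _ y ⟩
          y ∙ (A *ⱽ b i)   ≈⟨ ∙-congˡ y (eigenvector i (Fin.toℕ<n i)) ⟩
          y ∙ (μ i • b i)  ≈⟨ ∙-scaleʳ (μ i) y (b i) ⟩
          μ i * y ∙ b i    ≈⟨ *-congˡ (∙-comm y (b i)) ⟩
          μ i * b i ∙ y    ∎

      -- Diagonalises the quadratic form of x I - A, so its sign can be read off the factors x - μᵢ.
      -- It serves twice: at x = μ₂ for the form F, and at x = μₙ for the Rayleigh bound on the
      -- least eigenvalue.
      rayleigh-gap : ∀ x y → x * y ∙ y - y ∙ (A *ⱽ y) ≈ sum λ i → (x - μ i) * (weight i * (b i ∙ y * b i ∙ y))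
      rayleigh-gap x y = begin
        x * y ∙ y - y ∙ (A *ⱽ y)
          ≈⟨ +-cong (trans (*-congˡ (parseval y y)) (*-distribˡ-sum x w))
                 (trans (-‿cong (parseval-A y)) (sym (sum-neg (λ i → μ i * w i)))) ⟩
        (sum λ i → x * w i) + (sum λ i → - (μ i * w i))
          ≈⟨ ∑-distrib-+ (λ i → x * w i) (λ i → - (μ i * w i)) ⟨
        (sum λ i → x * w i - μ i * w i)
          ≈⟨ sum-cong-≋ (λ i → solve 3 (λ x m w → x :* w :- m :* w := (x :- m) :* w) refl x (μ i) (w i)) ⟩
        (sum λ i → (x - μ i) * w i) ∎
        where
        w : Vector Carrier n
        w i = weight i * (b i ∙ y * b i ∙ y)

-- Pinching by the color projectors, and the eigenvalue inequality.

module Pinching (ℝ : Reals) where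
  open SymmetricMatrices ℝ public
  open import Relation.Binary.Reasoning.Setoid setoid

  -- The dimension count cd < gd. The common factor d means that c < g suffices, whatever the
  -- dimension of the coloring, as long as d is positive.
  kernel₂ : ∀ {c g d} (M : Fin c × Fin d → Fin g × Fin d → Carrier) → c ℕ.< g → 0 ℕ.< d →
            ∃ λ (a : Fin g → Fin d → Carrier) → (∃₂ λ l e → ¬ (a l e ≈ 0#)) ×
              (∀ r → (sum λ l → sum λ e → M r (l , e) * a l e) ≈ 0#)
  kernel₂ {c} {g} {d@(suc _)} M c<g _
    with a , (i , aᵢ≉0) , Ma≈0 ← kernel {c ℕ.* d} {g ℕ.* d} (λ r q → M (remQuot d r) (remQuot d q))
           {Q = λ _ → ⊤} (λ _ → yes tt)
           (ℕ.≤-<-trans (count≤n {Q = λ _ → ⊤} (λ _ → yes tt)) (ℕ.*-monoˡ-< d c<g)) =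
    (λ l e → a (combine l e)) ,
    (proj₁ (remQuot {g} d i) , proj₂ (remQuot {g} d i) ,
     λ eq → aᵢ≉0 (trans (reflexive (≡.cong a (≡.sym (Fin.combine-remQuot {g} d i)))) eq)) ,
    λ { r@(k , e) → begin
      (sum λ l → sum λ e′ → M r (l , e′) * a (combine l e′))
        ≈⟨ sum-cong-≋ (λ l → sum-cong-≋ λ e′ → *-congʳ {a (combine l e′)}
             (reflexive (≡.cong₂ M (Fin.remQuot-combine k e) (Fin.remQuot-combine l e′)))) ⟨
      (sum λ (l : Fin g) → sum λ (e′ : Fin d) →
        M (remQuot {c} d (combine k e)) (remQuot {g} d (combine l e′)) * a (combine l e′))
        ≈⟨ sum-combine g {d} (λ q → M (remQuot {c} d (combine k e)) (remQuot {g} d q) * a q) ⟨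
      (sum λ q → M (remQuot {c} d (combine k e)) (remQuot {g} d q) * a q)
        ≈⟨ Ma≈0 (combine k e) _ ⟩
      0# ∎ }

  *ⱽ-assoc : ∀ {l m n} (P : Matrix l m) (Q : Matrix m n) y → P *ⱽ (Q *ⱽ y) ≋ (P *ᴹ Q) *ⱽ y
  *ⱽ-assoc P Q y i = begin
    P i ∙ (Q *ⱽ y)                                 ≈⟨ ∙-sumʳ (P i) (λ j k → Q k j * y j) ⟩
    (sum λ j → sum λ k → P i k * (Q k j * y j))
      ≈⟨ sum-cong-≋ (λ j → trans (sum-cong-≋ λ k → sym (*-assoc (P i k) (Q k j) (y j)))
                                 (sym (*-distribʳ-sum (y j) (λ k → P i k * Q k j)))) ⟩
    (P *ᴹ Q) i ∙ y                                 ∎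

  *ⱽ-∙-*ⱽ : ∀ {d} (P Q : Matrix d d) → (∀ a b → P a b ≈ P b a) → ∀ x y → (P *ⱽ x) ∙ (Q *ⱽ y) ≈ x ∙ ((P *ᴹ Q) *ⱽ y)
  *ⱽ-∙-*ⱽ P Q P-sym x y = trans (sym (SymmetricMatrix.*ⱽ-selfAdjoint P P-sym x (Q *ⱽ y))) (∙-congˡ x (*ⱽ-assoc P Q y))

  1ᴹ-∙ : ∀ {d} (y : Vector Carrier d) a → 1ᴹ a ∙ y ≈ y a
  1ᴹ-∙ y a = trans (sum-single a (λ b → 1ᴹ a b * y b) off) diag
    where
    off : ∀ b → b ≢ a → 1ᴹ a b * y b ≈ 0#
    off b b≢a with a Fin.≟ b
    ... | yes a≡b = contradiction (≡.sym a≡b) b≢a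
    ... | no  _   = zeroˡ (y b)
    diag : 1ᴹ a a * y a ≈ y a
    diag with a Fin.≟ a
    ... | yes _  = *-identityˡ (y a)
    ... | no a≢a = contradiction ≡.refl a≢a

  -- The projectors Pₖ = Σᵥ eᵥeᵥᵀ ⊗ P v k on ℝⁿ ⊗ ℝᵈ resolve the identity and
  -- satisfy Pₖ (A ⊗ I) Pₖ = 0.
  record RealColoring {n} (A : Matrix n n) (c d : ℕ) : Set where
    field
      P           : Fin n → Fin c → Matrix d d
      symmetric   : ∀ v k a b → P v k a b ≈ P v k b a
      idempotent  : ∀ v k → P v k *ᴹ P v k ≈ᴹ P v k
      complete    : ∀ v → sumᴹ (P v) ≈ᴹ 1ᴹ
      annihilates : ∀ v w k a b → A v w * (P v k *ᴹ P w k) a b ≈ 0#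

    -- An element of ℝⁿ ⊗ ℝᵈ is stored as its d components in ℝⁿ, on each of which A ⊗ I acts as
    -- `A`. In this form `pinch x k` is Pₖ x.
    pinch : (Fin d → Vector Carrier n) → Fin c → Fin d → Vector Carrier n
    pinch x k a v = P v k a ∙ λ b → x b v

    pinch-sum : ∀ x a v → (sum λ k → pinch x k a v) ≈ x a v
    pinch-sum x a v = begin
      (sum λ k → sum λ b → P v k a b * x b v)    ≈⟨ ∑-comm (λ k b → P v k a b * x b v) ⟩
      (sum λ b → sum λ k → P v k a b * x b v)    ≈⟨ sum-cong-≋ (λ b → sym (*-distribʳ-sum (x b v) (λ k → P v k a b))) ⟩
      sumᴹ (P v) a ∙ (λ b → x b v)               ≈⟨ ∙-congʳ (λ b → x b v) (complete v a) ⟩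
      1ᴹ a ∙ (λ b → x b v)                       ≈⟨ 1ᴹ-∙ (λ b → x b v) a ⟩
      x a v                                      ∎

    -- Each Pₖ is a symmetric idempotent, so ⟨Pₖ x, Pₖ x⟩ = ⟨x, Pₖ x⟩, and the right-hand sides add
    -- up to ⟨x, x⟩ by completeness.
    pinch-norm : ∀ x → (sum λ a → sum λ k → pinch x k a ∙ pinch x k a) ≈ sum λ a → x a ∙ x a
    pinch-norm x = begin
      (sum λ a → sum λ k → pinch x k a ∙ pinch x k a)
        ≈⟨ trans (∑-comm (λ a k → pinch x k a ∙ pinch x k a))
             (sum-cong-≋ λ k → ∑-comm (λ a v → pinch x k a v * pinch x k a v)) ⟩
      (sum λ k → sum λ v → (P v k *ⱽ λ b → x b v) ∙ (P v k *ⱽ λ b → x b v))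
        ≈⟨ sum-cong-≋ (λ k → sum-cong-≋ λ v → trans (*ⱽ-∙-*ⱽ (P v k) (P v k) (symmetric v k) (λ b → x b v) (λ b → x b v))
             (∙-congˡ (λ b → x b v) λ a → ∙-congʳ (λ b → x b v) (idempotent v k a))) ⟩
      (sum λ k → sum λ v → (λ b → x b v) ∙ (P v k *ⱽ λ b → x b v))
        ≈⟨ ∑-comm (λ k v → (λ b → x b v) ∙ (P v k *ⱽ λ b → x b v)) ⟩
      (sum λ v → sum λ k → (λ b → x b v) ∙ λ a → pinch x k a v)
        ≈⟨ sum-cong-≋ (λ v → trans (sym (∙-sumʳ (λ b → x b v) (λ k a → pinch x k a v)))
             (∙-congˡ (λ b → x b v) λ a → pinch-sum x a v)) ⟩
      (sum λ v → sum λ a → x a v * x a v)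
        ≈⟨ ∑-comm (λ v a → x a v * x a v) ⟩
      (sum λ a → x a ∙ x a) ∎

    -- Written out over pairs of vertices, the energy has the terms A v w ⟨x_v, P v k P w k x_w⟩,
    -- and `annihilates` kills each of them.
    pinch-A : ∀ x k → (sum λ a → pinch x k a ∙ (A *ⱽ pinch x k a)) ≈ 0#
    pinch-A x k = begin
      (sum λ a → y a ∙ (A *ⱽ y a))
        ≈⟨ sum-cong-≋ (λ a → ∙-sumʳ (y a) (λ w v → A v w * y a w)) ⟩
      (sum λ a → sum λ w → sum λ v → y a v * (A v w * y a w))
        ≈⟨ trans (∑-comm (λ a w → sum λ v → y a v * (A v w * y a w)))
             (sum-cong-≋ λ w → ∑-comm (λ a v → y a v * (A v w * y a w))) ⟩
      (sum λ w → sum λ v → sum λ a → y a v * (A v w * y a w))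
        ≈⟨ sum-zero (λ w → sum-zero λ v → edge v w) ⟩
      0# ∎
      where
      y : Fin d → Vector Carrier n
      y = pinch x k

      edge : ∀ v w → ((λ a → y a v) ∙ (A v w • λ a → y a w)) ≈ 0#
      edge v w = begin
        (λ a → y a v) ∙ (A v w • λ a → y a w)
          ≈⟨ ∙-scaleʳ (A v w) (λ a → y a v) (λ a → y a w) ⟩
        A v w * (P v k *ⱽ λ b → x b v) ∙ (P w k *ⱽ λ b → x b w)
          ≈⟨ *-congˡ (*ⱽ-∙-*ⱽ (P v k) (P w k) (symmetric v k) (λ b → x b v) (λ b → x b w)) ⟩
        A v w * (λ b → x b v) ∙ ((P v k *ᴹ P w k) *ⱽ λ b → x b w)
          ≈⟨ ∙-scaleʳ (A v w) (λ b → x b v) ((P v k *ᴹ P w k) *ⱽ λ b → x b w) ⟨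
        (λ b → x b v) ∙ (A v w • ((P v k *ᴹ P w k) *ⱽ λ b → x b w))
          ≈⟨ ∙-zeroʳ (λ b → x b v) (λ a → trans (*-distribˡ-sum (A v w) (λ b → (P v k *ᴹ P w k) a b * x b w))
               (sum-zero λ b → trans (sym (*-assoc (A v w) _ (x b w))) (trans (*-congʳ (annihilates v w k a b)) (zeroˡ _)))) ⟩
        0# ∎

  module _ {n c d : ℕ} {A : Matrix (suc n) (suc n)} (A-sym : ∀ i j → A i j ≈ A j i)
           {μ : Vector Carrier (suc n)} (bs : SymmetricMatrix.OrthogonalEigenvectors A A-sym μ (suc n))
           {μ₂ : Carrier} (μ≤μ₂ : ∀ i → μ (suc i) ≤ μ₂)
           (coloring : RealColoring A (suc c) d)
           where
    open SymmetricMatrix A A-sym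
    open OrthogonalEigenvectors bs
    open RealColoring coloring

    -- The form F on a single component in ℝⁿ. Throughout this module the number of colors χ is
    -- `suc c`.
    gap : Vector Carrier (suc n) → Carrier
    gap y = μ₂ * y ∙ y - y ∙ (A *ⱽ y)

    -- Orthogonality to b₀ makes gap positive semidefinite on the span of the yₖ.
    gap-sum-≤ : ∀ {s} (y : Fin (suc c) → Vector Carrier (suc n)) →
                (s ≋ λ v → sum λ k → y k v) → (∀ k → b zero ∙ y k ≈ 0#) →
                gap s ≤ fromℕ (suc c) * sum λ k → gap (y k)
    gap-sum-≤ {s} y s≋∑y b₀⊥y = ≤-respˡ-≈ (sym (rayleigh-gap bs μ₂ s)) (≤-respʳ-≈ rhs (sum-mono-≤ termwise))
      where
      N : Carrier
      N = fromℕ (suc c)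

      t : Fin (suc n) → Fin (suc c) → Carrier
      t i k = b i ∙ y k

      bs∙s : ∀ i → b i ∙ s ≈ sum (t i)
      bs∙s i = trans (∙-congˡ (b i) s≋∑y) (∙-sumʳ (b i) y)

      γ : Fin (suc n) → Carrier
      γ i = (μ₂ - μ i) * weight bs i

      γ-assoc : ∀ i x → (μ₂ - μ i) * (weight bs i * x) ≈ γ i * x
      γ-assoc i x = sym (*-assoc (μ₂ - μ i) (weight bs i) x)

      vanishes : ∀ {x} y z → x ≈ 0# → z * (x * y) ≈ 0#
      vanishes _ _ x≈0 = trans (*-congˡ (trans (*-congʳ x≈0) (zeroˡ _))) (zeroʳ _)

      termwise : ∀ i → (μ₂ - μ i) * (weight bs i * (b i ∙ s * b i ∙ s)) ≤ N * sum λ k → γ i * (t i k * t i k)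
      -- The coefficient μ₂ - μ₁ may be negative here, but orthogonality to `b zero` makes both
      -- sides vanish.
      termwise zero = ≤-reflexive (trans (trans (γ-assoc zero _) (vanishes _ _ (trans (bs∙s zero) (sum-zero b₀⊥y))))
        (sym (trans (*-congˡ (sum-zero λ k → vanishes (t zero k) (γ zero) (b₀⊥y k))) (zeroʳ N))))
      -- The coefficient is nonnegative, and Cauchy-Schwarz for the χ numbers ⟨bᵢ, yₖ⟩ costs the
      -- factor χ.
      termwise (suc i) = ≤-respˡ-≈ (sym (trans (γ-assoc (suc i) _) (*-congˡ (*-cong (bs∙s (suc i)) (bs∙s (suc i))))))
        (≤-respʳ-≈ rearrange (*-monoˡ-≤
          (*-nonNegative (x≤y⇒0≤y-x (μ≤μ₂ i)) (0≤weight bs (suc i))) (sum-square-≤ (t (suc i)))))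
        where
        q : Carrier
        q = sum λ k → t (suc i) k * t (suc i) k

        rearrange : γ (suc i) * (N * q) ≈ N * sum λ k → γ (suc i) * (t (suc i) k * t (suc i) k)
        rearrange = trans (solve 3 (λ γ N q → γ :* (N :* q) := N :* (γ :* q)) refl (γ (suc i)) N q)
          (*-congˡ (*-distribˡ-sum (γ (suc i)) (λ k → t (suc i) k * t (suc i) k)))

      rhs : (sum λ i → N * sum λ k → γ i * (t i k * t i k)) ≈ N * sum λ k → gap (y k)
      rhs = begin
        (sum λ i → N * sum λ k → γ i * (t i k * t i k))     ≈⟨ *-distribˡ-sum N (λ i → sum λ k → γ i * (t i k * t i k)) ⟨
        N * (sum λ i → sum λ k → γ i * (t i k * t i k))     ≈⟨ *-congˡ (∑-comm (λ i k → γ i * (t i k * t i k))) ⟩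
        N * (sum λ k → sum λ i → γ i * (t i k * t i k))     ≈⟨ *-congˡ (sum-cong-≋ λ k → trans
          (sum-cong-≋ λ i → sym (γ-assoc i (t i k * t i k))) (sym (rayleigh-gap bs μ₂ (y k)))) ⟩
        N * (sum λ k → gap (y k))                           ∎

    -- Summed over the components, the two sides of `gap-sum-≤` differ by S (c μ₂ + μₙ) with S > 0:
    -- the left side uses up one of the χ copies of μ₂ S, which leaves c = χ - 1.
    pinching-bound : ∀ {x μₙ} → (∀ a → Eigenspace A μₙ (x a)) → 0# < (sum λ a → x a ∙ x a) →
                     (∀ k a → b zero ∙ pinch x k a ≈ 0#) → 0# ≤ fromℕ c * μ₂ + μₙ
    pinching-bound {x} {μₙ} Ax≋μx 0<S b₀⊥x = 0≤x*y⇒0≤y 0<S (≤-respʳ-≈ difference (x≤y⇒0≤y-x bound))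
      where
      S : Carrier
      S = sum λ a → x a ∙ x a

      bound : (sum λ a → gap (x a)) ≤ (sum λ a → fromℕ (suc c) * sum λ k → gap (pinch x k a))
      bound = sum-mono-≤ λ a → gap-sum-≤ (λ k → pinch x k a) (λ v → sym (pinch-sum x a v)) (λ k → b₀⊥x k a)

      lhs : (sum λ a → gap (x a)) ≈ (μ₂ - μₙ) * S
      lhs = trans (sum-cong-≋ λ a → trans (+-congˡ (-‿cong (trans (∙-congˡ (x a) (Ax≋μx a)) (∙-scaleʳ μₙ (x a) (x a)))))
                (solve 3 (λ m l s → m :* s :- l :* s := (m :- l) :* s) refl μ₂ μₙ (x a ∙ x a)))
              (sym (*-distribˡ-sum (μ₂ - μₙ) (λ a → x a ∙ x a)))

      rhs : (sum λ a → fromℕ (suc c) * sum λ k → gap (pinch x k a)) ≈ fromℕ (suc c) * (μ₂ * S)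
      rhs = begin
        (sum λ a → fromℕ (suc c) * sum λ k → gap (pinch x k a))
          ≈⟨ *-distribˡ-sum (fromℕ (suc c)) (λ a → sum λ k → gap (pinch x k a)) ⟨
        fromℕ (suc c) * (sum λ a → sum λ k → gap (pinch x k a))
          ≈⟨ *-congˡ (trans (sum-cong-≋ λ a → ∑gap (λ k → norm k a) (λ k → energy k a))
                      (∑gap (λ a → sum λ k → norm k a) (λ a → sum λ k → energy k a))) ⟩
        fromℕ (suc c) * (μ₂ * (sum λ a → sum λ k → norm k a) - (sum λ a → sum λ k → energy k a))
          ≈⟨ *-congˡ (+-cong (*-congˡ (pinch-norm x)) (-‿cong (trans (∑-comm (λ a k → energy k a)) (sum-zero (pinch-A x))))) ⟩
        fromℕ (suc c) * (μ₂ * S - 0#)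
          ≈⟨ *-congˡ (trans (+-congˡ -0#≈0#) (+-identityʳ _)) ⟩
        fromℕ (suc c) * (μ₂ * S) ∎
        where
        norm energy : Fin (suc c) → Fin d → Carrier
        norm k a = pinch x k a ∙ pinch x k a
        energy k a = pinch x k a ∙ (A *ⱽ pinch x k a)

        ∑gap : ∀ {l} (f h : Vector Carrier l) → (sum λ i → μ₂ * f i - h i) ≈ μ₂ * sum f - sum h
        ∑gap f h = trans (∑-distrib-+ (λ i → μ₂ * f i) (λ i → - h i)) (+-cong (sym (*-distribˡ-sum μ₂ f)) (sum-neg h))

      difference : (sum λ a → fromℕ (suc c) * sum λ k → gap (pinch x k a)) - (sum λ a → gap (x a)) ≈
                   S * (fromℕ c * μ₂ + μₙ)
      difference = trans (+-cong rhs (-‿cong lhs))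
        (solve 4 (λ c m l s → (con (ℤ.+ 1) :+ c) :* (m :* s) :- (m :- l) :* s := s :* (c :* m :+ l)) refl (fromℕ c) μ₂ μₙ S)

    eigenspace-bound : ∀ {μₙ g} → HasMultiplicity A μₙ g → ¬ (μ zero ≈ μₙ) → 0 ℕ.< d → c ℕ.< g → 0# ≤ fromℕ c * μ₂ + μₙ
    eigenspace-bound {μₙ} {g} (β , Aβ≋μβ , independent , _) μ₀≉μₙ 0<d c<g
      -- The unknowns are the coefficients of a vector `x` of E(μₙ) ⊗ ℝᵈ in the basis `β`. Equations
      -- are imposed for the colors `suc k` only; leaving out color `zero` brings their number down
      -- to c d.
      with α , (l₀ , a₀ , α≉0) , solves ←
        kernel₂ {c} {g} {d} (λ (k , a) (l , e) → b zero ∙ λ v → P v (suc k) a e * β l v) c<g 0<d =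
      pinching-bound Ax≋μx 0<S b₀⊥pinch
      where
      x : Fin d → Vector Carrier (suc n)
      x a = linearCombination (λ l → α l a) β

      Ax≋μx : ∀ a → Eigenspace A μₙ (x a)
      Ax≋μx a = linearCombination-eigenspace (λ l → α l a) Aβ≋μβ

      0<S : 0# < (sum λ a → x a ∙ x a)
      0<S = sum-nonNegative (λ a → 0≤u∙u (x a)) , λ 0≈S →
        α≉0 (independent (λ l → α l a₀) (u∙u≈0⇒u≋0 (x a₀) (sum≈0⇒≈0 (λ a → 0≤u∙u (x a)) (sym 0≈S) a₀)) l₀)

      b₀⊥pinch-suc : ∀ k a → b zero ∙ pinch x (suc k) a ≈ 0#
      b₀⊥pinch-suc k a = begin
        b zero ∙ pinch x (suc k) a
          ≈⟨ ∙-sumʳ (b zero) (λ e v → P v (suc k) a e * x e v) ⟩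
        (sum λ e → b zero ∙ λ v → P v (suc k) a e * x e v)
          ≈⟨ sum-cong-≋ (λ e → trans (∙-congˡ (b zero) λ v → *-distribˡ-sum (P v (suc k) a e) (λ l → α l e * β l v))
                                     (∙-sumʳ (b zero) (λ l v → P v (suc k) a e * (α l e * β l v)))) ⟩
        (sum λ e → sum λ l → b zero ∙ λ v → P v (suc k) a e * (α l e * β l v))
          ≈⟨ sum-cong-≋ (λ e → sum-cong-≋ λ l → trans
               (∙-congˡ (b zero) λ v → solve 3 (λ p a b → p :* (a :* b) := a :* (p :* b)) refl (P v (suc k) a e) (α l e) (β l v))
               (trans (∙-scaleʳ (α l e) (b zero) (λ v → P v (suc k) a e * β l v)) (*-comm _ _))) ⟩
        (sum λ e → sum λ l → (b zero ∙ λ v → P v (suc k) a e * β l v) * α l e)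
          ≈⟨ ∑-comm (λ e l → (b zero ∙ λ v → P v (suc k) a e * β l v) * α l e) ⟩
        (sum λ l → sum λ e → (b zero ∙ λ v → P v (suc k) a e * β l v) * α l e)
          ≈⟨ solves (k , a) ⟩
        0# ∎

      b₀⊥pinch : ∀ k a → b zero ∙ pinch x k a ≈ 0#
      b₀⊥pinch (suc k) a = b₀⊥pinch-suc k a
      -- The pinched parts add up to `x a`, which lies in E(μₙ) and so is orthogonal to `b zero`;
      -- the other colors contribute nothing, hence neither does this one.
      b₀⊥pinch zero    a = begin
        b zero ∙ pinch x zero a                           ≈⟨ +-identityʳ _ ⟨
        b zero ∙ pinch x zero a + 0#                      ≈⟨ +-congˡ (sum-zero λ k → b₀⊥pinch-suc k a) ⟨
        (sum λ k → b zero ∙ pinch x k a)                  ≈⟨ ∙-sumʳ (b zero) (λ k → pinch x k a) ⟨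
        (b zero ∙ λ v → sum λ k → pinch x k a v)          ≈⟨ ∙-congˡ (b zero) (pinch-sum x a) ⟩
        b zero ∙ x a                                      ≈⟨ eigenvectors-orthogonal (eigenvector zero (s≤s z≤n)) (Ax≋μx a) μ₀≉μₙ ⟩
        0#                                                ∎

-- The adjacency matrix and its least eigenvalue.

module Adjacency (ℝ : Reals) where
  open Pinching ℝ public
  open import Relation.Binary.Reasoning.Setoid setoid

  adjacencyMatrix-symmetric : ∀ {n} (G : Graph n) v w → adjacencyMatrix G v w ≈ adjacencyMatrix G w v
  adjacencyMatrix-symmetric G v w with Graph._~?_ G v w | Graph._~?_ G w v
  ... | yes _   | yes _   = refl
  ... | yes v~w | no w≁v  = contradiction (Graph.~-sym G v~w) w≁v
  ... | no v≁w  | yes w~v = contradiction (Graph.~-sym G w~v) v≁w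
  ... | no _    | no _    = refl

  adjacencyMatrix-diagonal : ∀ {n} (G : Graph n) v → adjacencyMatrix G v v ≈ 0#
  adjacencyMatrix-diagonal G v with Graph._~?_ G v v
  ... | yes v~v = contradiction v~v (Graph.~-irrefl G ≡.refl)
  ... | no _    = refl

  module _ {n} {A : Matrix (suc n) (suc n)} (A-sym : ∀ i j → A i j ≈ A j i) {μ : Vector Carrier (suc n)}
           (bs : SymmetricMatrix.OrthogonalEigenvectors A A-sym μ (suc n)) where
    open SymmetricMatrix A A-sym
    open OrthogonalEigenvectors bs

    -- The Rayleigh quotient at the first unit vector is the diagonal entry.
    leastEigenvalue≤diagonal : ∀ {μₙ} → (∀ i → μₙ ≤ μ i) → μₙ ≤ A zero zero
    leastEigenvalue≤diagonal {μₙ} μₙ≤μ = 0≤y-x⇒x≤y (≤-respʳ-≈ difference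
      (sum-nonNegative λ i → *-nonNegative (x≤y⇒0≤y-x (μₙ≤μ i)) (*-nonNegative (0≤weight bs i) (0≤x*x (b i ∙ e)))))
      where
      e : Vector Carrier (suc n)
      e = 1ᴹ zero

      e∙Ae : e ∙ (A *ⱽ e) ≈ A zero zero
      e∙Ae = trans (1ᴹ-∙ (A *ⱽ e) zero) (trans (∙-comm (A zero) e) (1ᴹ-∙ (A zero) zero))

      difference : (sum λ i → (μ i - μₙ) * (weight bs i * (b i ∙ e * b i ∙ e))) ≈ A zero zero - μₙ
      difference = begin
        (sum λ i → (μ i - μₙ) * w i)
          ≈⟨ sum-cong-≋ (λ i → solve 3 (λ m l w → (m :- l) :* w := :- ((l :- m) :* w)) refl (μ i) μₙ (w i)) ⟩
        (sum λ i → - ((μₙ - μ i) * w i))    ≈⟨ trans (sum-neg λ i → (μₙ - μ i) * w i) (-‿cong (sym (rayleigh-gap bs μₙ e))) ⟩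
        - (μₙ * e ∙ e - e ∙ (A *ⱽ e))       ≈⟨ -‿cong (+-cong (trans (*-congˡ (1ᴹ-∙ e zero)) (*-identityʳ μₙ)) (-‿cong e∙Ae)) ⟩
        - (μₙ - A zero zero)                ≈⟨ solve 2 (λ l a → :- (l :- a) := a :- l) refl μₙ (A zero zero) ⟩
        A zero zero - μₙ                    ∎
        where
        w : Vector Carrier (suc n)
        w i = weight bs i * (b i ∙ e * b i ∙ e)

-- From complex projectors to real symmetric ones.

module Realification (ℝ : Reals) where
  open Adjacency ℝ public
  open Complex ℝ using (re; im)
  open QuantumColoring ℝ renaming (module QuantumColoring to Coloring)
  private module ℂ = LinearAlgebra (Complex.rawRing ℝ)
  open import Relation.Binary.Reasoning.Setoid setoid

  -- x + iy ↦ [[x, −y], [y, x]], blockwise.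
  block : ∀ {d} → ℂ.Matrix d d → Fin d ⊎ Fin d → Fin d ⊎ Fin d → Carrier
  block M (inj₁ i) (inj₁ j) = re (M i j)
  block M (inj₁ i) (inj₂ j) = - im (M i j)
  block M (inj₂ i) (inj₁ j) = im (M i j)
  block M (inj₂ i) (inj₂ j) = re (M i j)

  realify : ∀ {d} → ℂ.Matrix d d → Matrix (d ℕ.+ d) (d ℕ.+ d)
  realify {d} M i j = block M (splitAt d i) (splitAt d j)

  block-cong : ∀ {d} {M N : ℂ.Matrix d d} → M ℂ.≈ᴹ N → ∀ s t → block M s t ≈ block N s t
  block-cong M≈N (inj₁ i) (inj₁ j) = proj₁ (M≈N i j)
  block-cong M≈N (inj₁ i) (inj₂ j) = -‿cong (proj₂ (M≈N i j))
  block-cong M≈N (inj₂ i) (inj₁ j) = proj₂ (M≈N i j)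
  block-cong M≈N (inj₂ i) (inj₂ j) = proj₁ (M≈N i j)

  -- A Hermitian matrix has symmetric real part and antisymmetric imaginary part; the minus sign in
  -- the upper right block turns the latter into symmetry.
  block-symmetric : ∀ {d} {M : ℂ.Matrix d d} → M † ℂ.≈ᴹ M → ∀ s t → block M s t ≈ block M t s
  block-symmetric M†≈M (inj₁ i) (inj₁ j) = sym (proj₁ (M†≈M i j))
  block-symmetric M†≈M (inj₁ i) (inj₂ j) = trans (-‿cong (sym (proj₂ (M†≈M i j)))) (solve 1 (λ x → :- :- x := x) refl _)
  block-symmetric M†≈M (inj₂ i) (inj₁ j) = sym (proj₂ (M†≈M i j))
  block-symmetric M†≈M (inj₂ i) (inj₂ j) = sym (proj₁ (M†≈M i j))

  block-0 : ∀ {d} s t → block {d} ℂ.0ᴹ s t ≈ 0#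
  block-0 (inj₁ i) (inj₁ j) = refl
  block-0 (inj₁ i) (inj₂ j) = -0#≈0#
  block-0 (inj₂ i) (inj₁ j) = refl
  block-0 (inj₂ i) (inj₂ j) = refl

  -- Phrased through `join` because the real `1ᴹ` compares indices of Fin (d + d); injectivity of
  -- `join` carries the comparison back to the blocks.
  block-1 : ∀ {d} s t → block ℂ.1ᴹ s t ≈ 1ᴹ (join d d s) (join d d t)
  block-1 {d} s t with join d d s Fin.≟ join d d t
  ... | yes eq = trans (reflexive (≡.cong (block ℂ.1ᴹ s) (≡.sym (join-injective s t eq)))) (diagonal s)
    where
    join-injective : ∀ s t → join d d s ≡ join d d t → s ≡ t
    join-injective s t eq = ≡.trans (≡.sym (Fin.splitAt-join d d s)) (≡.trans (≡.cong (splitAt d) eq) (Fin.splitAt-join d d t))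
    diagonal : ∀ s → block {d} ℂ.1ᴹ s s ≈ 1#
    diagonal (inj₁ i) with i Fin.≟ i
    ... | yes _  = refl
    ... | no i≢i = contradiction ≡.refl i≢i
    diagonal (inj₂ i) with i Fin.≟ i
    ... | yes _  = refl
    ... | no i≢i = contradiction ≡.refl i≢i
  ... | no neq = offDiagonal s t (neq ∘ ≡.cong (join d d))
    where
    im-1ᴹ : ∀ i j → im (ℂ.1ᴹ {d} i j) ≈ 0#
    im-1ᴹ i j with i Fin.≟ j
    ... | yes _ = refl
    ... | no  _ = refl
    offDiagonal : ∀ s t → s ≢ t → block {d} ℂ.1ᴹ s t ≈ 0#
    offDiagonal (inj₁ i) (inj₁ j) s≢t with i Fin.≟ j
    ... | yes i≡j = contradiction (≡.cong inj₁ i≡j) s≢t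
    ... | no  _   = refl
    offDiagonal (inj₁ i) (inj₂ j) s≢t = trans (-‿cong (im-1ᴹ i j)) -0#≈0#
    offDiagonal (inj₂ i) (inj₁ j) s≢t = im-1ᴹ i j
    offDiagonal (inj₂ i) (inj₂ j) s≢t with i Fin.≟ j
    ... | yes i≡j = contradiction (≡.cong inj₂ i≡j) s≢t
    ... | no  _   = refl

  realify-1 : ∀ {d} → realify {d} ℂ.1ᴹ ≈ᴹ 1ᴹ
  realify-1 {d} i j = trans (block-1 (splitAt d i) (splitAt d j))
    (reflexive (≡.cong₂ 1ᴹ (Fin.join-splitAt d d i) (Fin.join-splitAt d d j)))

  open RawSemiringDefinitions (RawRing.rawSemiring (Complex.rawRing ℝ)) using () renaming (sum to ∑)

  -- The complex numbers come as a raw ring only, so complex sums are reduced to real ones part by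
  -- part.
  re-∑ : ∀ {n} (f : Vector (Complex.ℂ ℝ) n) → re (∑ f) ≈ sum (re ∘ f)
  re-∑ {zero}  f = refl
  re-∑ {suc n} f = +-congˡ (re-∑ (f ∘ suc))

  im-∑ : ∀ {n} (f : Vector (Complex.ℂ ℝ) n) → im (∑ f) ≈ sum (im ∘ f)
  im-∑ {zero}  f = refl
  im-∑ {suc n} f = +-congˡ (im-∑ (f ∘ suc))

  block-sum : ∀ {c d} (M : Vector (ℂ.Matrix d d) c) s t → (sum λ k → block (M k) s t) ≈ block (ℂ.sumᴹ M) s t
  block-sum M (inj₁ i) (inj₁ j) = sym (re-∑ λ k → M k i j)
  block-sum M (inj₁ i) (inj₂ j) = trans (sum-neg λ k → im (M k i j)) (-‿cong (sym (im-∑ λ k → M k i j)))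
  block-sum M (inj₂ i) (inj₁ j) = sym (im-∑ λ k → M k i j)
  block-sum M (inj₂ i) (inj₂ j) = sym (re-∑ λ k → M k i j)

  -- The embedding of ℂ into real 2 × 2 matrices is multiplicative. The two sums are the two halves
  -- of the middle index of the real product.
  block-* : ∀ {d} (M N : ℂ.Matrix d d) s t →
            (sum λ k → block M s (inj₁ k) * block N (inj₁ k) t) + (sum λ k → block M s (inj₂ k) * block N (inj₂ k) t) ≈
            block (M ℂ.*ᴹ N) s t
  block-* M N s t = trans
    (sym (∑-distrib-+ (λ k → block M s (inj₁ k) * block N (inj₁ k) t)
                      (λ k → block M s (inj₂ k) * block N (inj₂ k) t)))
    (entries s t)
    where
    open Complex ℝ using (ℂ)
    _·_ : ℂ → ℂ → ℂ
    _·_ = RawRing._*_ (Complex.rawRing ℝ)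

    entries : ∀ s t → (sum λ k → block M s (inj₁ k) * block N (inj₁ k) t + block M s (inj₂ k) * block N (inj₂ k) t) ≈
              block (M ℂ.*ᴹ N) s t
    entries (inj₁ i) (inj₁ j) = trans
      (sum-cong-≋ λ k → solve 4 (λ a b c d → a :* c :+ :- b :* d := a :* c :+ :- (b :* d)) refl
        (re (M i k)) (im (M i k)) (re (N k j)) (im (N k j)))
      (sym (re-∑ λ k → M i k · N k j))
    entries (inj₁ i) (inj₂ j) = trans
      (sum-cong-≋ λ k → solve 4 (λ a b c d → a :* :- d :+ :- b :* c := :- (a :* d :+ b :* c)) refl
        (re (M i k)) (im (M i k)) (re (N k j)) (im (N k j)))
      (trans (sum-neg λ k → im (M i k · N k j)) (-‿cong (sym (im-∑ λ k → M i k · N k j))))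
    entries (inj₂ i) (inj₁ j) = trans
      (sum-cong-≋ λ k → solve 4 (λ a b c d → b :* c :+ a :* d := a :* d :+ b :* c) refl
        (re (M i k)) (im (M i k)) (re (N k j)) (im (N k j)))
      (sym (im-∑ λ k → M i k · N k j))
    entries (inj₂ i) (inj₂ j) = trans
      (sum-cong-≋ λ k → solve 4 (λ a b c d → b :* :- d :+ a :* c := a :* c :+ :- (b :* d)) refl
        (re (M i k)) (im (M i k)) (re (N k j)) (im (N k j)))
      (sym (re-∑ λ k → M i k · N k j))

  realify-* : ∀ {d} (M N : ℂ.Matrix d d) → realify M *ᴹ realify N ≈ᴹ realify (M ℂ.*ᴹ N)
  realify-* {d} M N i j = begin
    (sum λ k → f (splitAt d k))                              ≈⟨ sum-↑ d (λ k → f (splitAt d k)) ⟩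
    (sum λ k → f (splitAt d (k ↑ˡ d))) + (sum λ k → f (splitAt d (d ↑ʳ k)))
      ≈⟨ +-cong (sum-cong-≋ λ k → reflexive (≡.cong f (Fin.splitAt-↑ˡ d k d)))
                (sum-cong-≋ λ k → reflexive (≡.cong f (Fin.splitAt-↑ʳ d d k))) ⟩
    (sum λ k → f (inj₁ k)) + (sum λ k → f (inj₂ k))          ≈⟨ block-* M N (splitAt d i) (splitAt d j) ⟩
    realify (M ℂ.*ᴹ N) i j                                   ∎
    where
    f : Fin d ⊎ Fin d → Carrier
    f s = block M (splitAt d i) s * block N s (splitAt d j)

  realColoring : ∀ {n c d} {G : Graph n} → QuantumColoring G c d → RealColoring (adjacencyMatrix G) c (d ℕ.+ d)
  realColoring {d = d} {G} Q = record
    { P           = λ v k → realify (P v k)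
    ; symmetric   = λ v k a b → block-symmetric (proj₂ (isProjector v k)) (splitAt d a) (splitAt d b)
    ; idempotent  = λ v k a b → trans (realify-* (P v k) (P v k) a b)
                      (block-cong (proj₁ (isProjector v k)) (splitAt d a) (splitAt d b))
    ; complete    = λ v a b → trans (block-sum (P v) (splitAt d a) (splitAt d b))
                      (trans (block-cong (complete v) (splitAt d a) (splitAt d b)) (realify-1 {d} a b))
    ; annihilates = annihilates
    }
    where
    open Coloring Q
    open Graph G
    annihilates : ∀ v w k a b → adjacencyMatrix G v w * (realify (P v k) *ᴹ realify (P w k)) a b ≈ 0#
    annihilates v w k a b with v ~? w
    ... | yes v~w = trans (*-identityˡ _) (trans (realify-* (P v k) (P w k) a b)
                      (trans (block-cong (proper v~w k) (splitAt d a) (splitAt d b)) (block-0 (splitAt d a) (splitAt d b))))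
    ... | no  _   = zeroˡ _

  -- With no colors the completeness sum is empty, so at some vertex, in positive dimension, a
  -- diagonal entry of the identity would be 0.
  ¬QuantumColorable-0 : ∀ {n} {G : Graph (suc n)} → ¬ QuantumColorable G 0
  ¬QuantumColorable-0 (suc d , _ , Q) = 1≉0 (sym (proj₁ (Coloring.complete Q zero zero zero)))

-- The bound for the number of colors of any quantum coloring.

module Bound (ℝ : Reals) where
  open Realification ℝ
  open QuantumColoring ℝ
  open import Relation.Binary.Reasoning.PartialOrder poset
  private
    module Max = NaturalMax (DecTotalOrder.totalOrder decTotalOrder)
    module Min = NaturalMin (DecTotalOrder.totalOrder decTotalOrder)

  quantumColoring-bound : ∀ {m} (G : Graph (2 ℕ.+ m)) {μ} → IsSpectrum (adjacencyMatrix G) μ → 0# < μ (suc zero) →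
    ∀ {g} → HasMultiplicity (adjacencyMatrix G) (μ (Fin.fromℕ (suc m))) g →
    ∀ {c} → QuantumColorable G c →
    1# + (fromℕ g ⊓ (∣ μ (Fin.fromℕ (suc m)) ∣ / μ (suc zero))) ≤ fromℕ c
  quantumColoring-bound G _ _ _ {zero} colorable = contradiction colorable ¬QuantumColorable-0
  -- With `suc c` colors the summand 1 splits off on both sides, and `c` is χ - 1 from here on.
  quantumColoring-bound {m} G {μ} (μ-antitone , multiplicity) 0<μ₂@(0≤μ₂ , 0≉μ₂) {g} mult {suc c} (d , 0<d , Q) =
    +-mono-≤ ≤-refl bound
    where
    A : Matrix (2 ℕ.+ m) (2 ℕ.+ m)
    A = adjacencyMatrix G
    A-sym : ∀ i j → A i j ≈ A j i
    A-sym = adjacencyMatrix-symmetric G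
    μ₂ μₙ : Carrier
    μ₂ = μ (suc zero)
    μₙ = μ (Fin.fromℕ (suc m))

    bs : SymmetricMatrix.OrthogonalEigenvectors A A-sym μ (2 ℕ.+ m)
    bs = SymmetricMatrix.orthogonalEigenvectors A A-sym multiplicity (2 ℕ.+ m) ℕ.≤-refl

    μₙ≤0 : μₙ ≤ 0#
    μₙ≤0 = ≤-respʳ-≈ (adjacencyMatrix-diagonal G zero)
      (leastEigenvalue≤diagonal A-sym bs λ i → μ-antitone (Fin.≤fromℕ i))

    -- Equality would squeeze μ₂ between 0 and μₙ ≤ 0. Distinctness is what makes the μₙ-eigenspace
    -- orthogonal to the first eigenvector.
    μ₁≉μₙ : ¬ (μ zero ≈ μₙ)
    μ₁≉μₙ μ₁≈μₙ = 0≉μ₂ (≤-antisym 0≤μ₂ (≤-trans (μ-antitone z≤n) (≤-trans (≤-reflexive μ₁≈μₙ) μₙ≤0)))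

    ratio-bound : c ℕ.< g → ∣ μₙ ∣ / μ₂ ≤ fromℕ c
    ratio-bound c<g = begin
      ∣ μₙ ∣ * μ₂ ⁻¹             ≈⟨ *-comm _ _ ⟩
      μ₂ ⁻¹ * ∣ μₙ ∣             ≤⟨ *-monoˡ-≤ (⁻¹-nonNegative 0<μ₂) ∣μₙ∣≤cμ₂ ⟩
      μ₂ ⁻¹ * (fromℕ c * μ₂)     ≈⟨ solve 3 (λ i c m → i :* (c :* m) := i :* m :* c) refl (μ₂ ⁻¹) (fromℕ c) μ₂ ⟩
      μ₂ ⁻¹ * μ₂ * fromℕ c       ≈⟨ *-congʳ (⁻¹-inverseˡ μ₂ (0≉μ₂ ∘ sym)) ⟩
      1# * fromℕ c               ≈⟨ *-identityˡ _ ⟩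
      fromℕ c                    ∎
      where
      0≤cμ₂+μₙ : 0# ≤ fromℕ c * μ₂ + μₙ
      0≤cμ₂+μₙ = eigenspace-bound A-sym bs (λ i → μ-antitone (s≤s z≤n)) (realColoring Q) mult μ₁≉μₙ
        (ℕ.<-≤-trans 0<d (ℕ.m≤m+n d d)) c<g

      ∣μₙ∣≤cμ₂ : ∣ μₙ ∣ ≤ fromℕ c * μ₂
      -- The absolute value is the larger of μₙ, which is at most 0, and -μₙ, which the eigenspace
      -- bound controls.
      ∣μₙ∣≤cμ₂ = Max.⊔-lub
        (≤-trans μₙ≤0 (*-nonNegative (fromℕ-mono-≤ {n = c} z≤n) 0≤μ₂))
        (0≤y-x⇒x≤y (≤-respʳ-≈ (solve 2 (λ x y → x :+ y := x :- :- y) refl (fromℕ c * μ₂) μₙ) 0≤cμ₂+μₙ))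

    bound : fromℕ g ⊓ (∣ μₙ ∣ / μ₂) ≤ fromℕ c
    -- Either the first argument of the minimum is small enough, or g ≥ χ and the eigenspace of μₙ
    -- is large enough for the pinching argument.
    bound with g ℕ.≤? c
    ... | yes g≤c = ≤-trans (Min.x⊓y≤x _ _) (fromℕ-mono-≤ g≤c)
    ... | no  g≰c = ≤-trans (Min.x⊓y≤y _ _) (ratio-bound (ℕ.≰⇒> g≰c))

theorem3 : (ℝ : Reals) →
    let open Reals ℝ
        open Spectrum ℝ
        open QuantumColoring ℝ
    in
    (m : ℕ) → let n = 2 ℕ.+ m in
    (G : Graph n) → Connected G →
    (μ : Vector Carrier n) → IsSpectrum (adjacencyMatrix G) μ →
    let μ₂ = μ (suc zero)
        μₙ = μ (Fin.fromℕ (1 ℕ.+ m))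
    in
    0# < μ₂ →
    (g : ℕ) → HasMultiplicity (adjacencyMatrix G) μₙ g →
    (χ : ℕ) → IsQuantumChromaticNumber G χ →
    1# + (fromℕ g ⊓ (∣ μₙ ∣ / μ₂)) ≤ fromℕ χ
theorem3 ℝ m G _ μ spectrum 0<μ₂ g mult χ (colorable , _) =
  Bound.quantumColoring-bound ℝ G spectrum 0<μ₂ mult colorable
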